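{- For every $m\ge1$ and every step profile $\boldsymbol h=(h_1,\dots,h_m)$ with $h_1\ge\cdots\ge h_m>0$, $$\mathrm{MF}_m(\boldsymbol h)=\mathrm{MC}_m(\boldsymbol h)=\min_{(\boldsymbol a,\boldsymbol b)\in\mathcal T_m}\Gamma_m^{\boldsymbol h}(\boldsymbol a,\boldsymbol b).$$
   Context: Write $[m]=\{1,\dots,m\}$ and put $h_{m+1}:=0$. **Coefficients.** For $i,j\in[m]$ let $g_{ij}=\frac{h_j}{h_i+h_j}$, $g_{i,m+1}=0$, and $$q_{ij}=g_{ij}-g_{i,j+1},\qquad r_{ij}=(m-j+1)g_{ij}-(m-j)g_{i,j+1}.$$ **Discrete threshold game.** For $\boldsymbol a,\boldsymbol b\in\{0,\dots,m\}^m$ put $U_{ij}=\mathbf 1\{j>a_i\}$, $\widetilde V_{ij}=\mathbf 1\{i>b_j\}$, $S_{ij}=(1-U_{ij})(1-\widetilde V_{ij})$, $P_i=g_{i,a_i+1}$, $Q_j=g_{j,b_j+1}$. Let $\mathcal T_m$ be the set of pairs $(\boldsymbol a,\boldsymbol b)$ with $U_{ij}\widetilde V_{ij}=0$ for all $i,j\in[m]$, and for such pairs $$\Gamma_m^{\boldsymbol h}(\boldsymbol a,\boldsymbol b)=\frac1{m^2}\sum_{i,j=1}^m\bigl[S_{ij}+(U_{ij}+\widetilde V_{ij})(P_i+Q_j)\bigr].$$ **Network $\mathcal N_m(\boldsymbol h)$.** The directed network has source $s$, sink $t$, and nodes $\mathsf X_{ij},\mathsf Y_{ij}$ for $i,j\in[m]$.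 Its arcs (parallel arcs counted separately) are, for all $i,j\in[m]$: - $s\to\mathsf Y_{ij}$ with capacity $r_{ji}/m^2$; - $\mathsf Y_{ij}\to\mathsf X_{ij}$ with capacity $1/m^2$; - $\mathsf X_{ij}\to t$ with capacity $r_{ij}/m^2$; - $\mathsf X_{ij}\to\mathsf Y_{ik}$ with capacity $q_{ij}/m^2$, for each $k\in[m]$; - $\mathsf X_{ij}\to\mathsf Y_{kj}$ with capacity $q_{jk}/m^2$, for each $k\in[m]$; - the implication arcs $\mathsf X_{ij}\to\mathsf Y_{ij}$, $\mathsf X_{ij}\to\mathsf X_{i,j+1}$ (for $j<m$), and $\mathsf Y_{i+1,j}\to\mathsf Y_{ij}$ (for $i<m$), each with capacity $2$. $\mathrm{MC}_m(\boldsymbol h)$ and $\mathrm{MF}_m(\boldsymbol h)$ denote the minimum $s$–$t$ cut value and the maximum $s$–$t$ flow value of $\mathcal N_m(\boldsymbol h)$. -}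

module Defs where

open import Algebra.Bundles using (CommutativeRing)
import Algebra.Properties.Semiring.Mult as Mult
import Algebra.Properties.Semiring.Sum as Sum
open import Data.Bool.Base using (Bool; true; false; if_then_else_; _∧_; not)
open import Data.Fin.Base as Fin using (Fin; zero; suc; toℕ; inject₁)
import Data.Fin.Properties as Fin
open import Data.Fin.Relation.Unary.Top using (view; ‵fromℕ; ‵inject₁)
open import Data.List.Base
  using (List; []; _∷_; _++_; map; concatMap; allFin; length; lookup)
open import Data.Nat.Base as ℕ using (ℕ; suc; _∸_)
import Data.Nat.Properties as ℕ
open import Data.Product.Base using (Σ-syntax; ∃-syntax; _×_; _,_)
open import Function.Base using (_∘_)
open import Level using (_⊔_) renaming (suc to lsuc)
open import Relation.Binary.Core using (Rel)
open import Relation.Binary.Definitions using (DecidableEquality)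
import Relation.Binary.Construct.NonStrictToStrict as NonStrictToStrict
open import Relation.Binary.PropositionalEquality using (_≡_; _≢_; refl)
open import Relation.Binary.Structures using (IsDecTotalOrder)
open import Relation.Nullary.Decidable using (Dec; yes; no; does; map′; _×-dec_)

-- A linearly ordered field, in the classical sense (the order is decidable).
-- The inverse is total, but unspecified at 0#.
record OrderedField c ℓ₁ ℓ₂ : Set (lsuc (c ⊔ ℓ₁ ⊔ ℓ₂)) where
  infix  4 _≤_
  infix  8 _⁻¹
  infixl 7 _/_

  field
    commutativeRing : CommutativeRing c ℓ₁

  open CommutativeRing commutativeRing public

  field
    _≤_             : Rel Carrier ℓ₂
    _⁻¹             : Carrier → Carrier
    isDecTotalOrder : IsDecTotalOrder _≈_ _≤_
    0≉1             : 0# ≉ 1#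
    ⁻¹-inverseʳ     : ∀ x → x ≉ 0# → x * x ⁻¹ ≈ 1#
    +-monoʳ-≤       : ∀ x {y z} → y ≤ z → x + y ≤ x + z
    *-nonNegative   : ∀ {x y} → 0# ≤ x → 0# ≤ y → 0# ≤ x * y

  open NonStrictToStrict _≈_ _≤_ public using (_<_)

  _/_ : Carrier → Carrier → Carrier
  x / y = x * y ⁻¹

module Over {c ℓ₁ ℓ₂} (K : OrderedField c ℓ₁ ℓ₂) where

  open OrderedField K hiding (refl)
  open Mult semiring renaming (_×_ to _·_)
  open Sum semiring

  indicator : ∀ {p} {P : Set p} → Dec P → Carrier
  indicator P? = if does P? then 1# else 0#

  IsMinimum : ∀ {a} {A : Set a} → (A → Carrier) → Carrier → Set (a ⊔ ℓ₁ ⊔ ℓ₂)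
  IsMinimum f v = (∃[ x ] f x ≈ v) × (∀ x → v ≤ f x)

  IsMaximum : ∀ {a} {A : Set a} → (A → Carrier) → Carrier → Set (a ⊔ ℓ₁ ⊔ ℓ₂)
  IsMaximum f v = (∃[ x ] f x ≈ v) × (∀ x → f x ≤ v)

  record Arc (Node : Set) : Set c where
    constructor _⟶_[_]
    field
      tail     : Node
      head     : Node
      capacity : Carrier

  -- Arcs are identified by their position in the list, so that parallel arcs
  -- are distinct.
  record Network : Set (lsuc c) where
    field
      Node   : Set
      _≟_    : DecidableEquality Node
      source : Node
      sink   : Node
      arcs   : List (Arc Node)

    ArcIndex : Set
    ArcIndex = Fin (length arcs)

    tail head : ArcIndex → Node
    tail = Arc.tail ∘ lookup arcs
    head = Arc.head ∘ lookup arcs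

    capacity : ArcIndex → Carrier
    capacity = Arc.capacity ∘ lookup arcs

    inflow outflow : (ArcIndex → Carrier) → Node → Carrier
    inflow  f v = sum λ e → indicator (head e ≟ v) * f e
    outflow f v = sum λ e → indicator (tail e ≟ v) * f e

    record Flow : Set (c ⊔ ℓ₁ ⊔ ℓ₂) where
      field
        amount       : ArcIndex → Carrier
        nonNegative  : ∀ e → 0# ≤ amount e
        feasible     : ∀ e → amount e ≤ capacity e
        conservation : ∀ v → v ≢ source → v ≢ sink →
                       inflow amount v ≈ outflow amount v

    flowValue : Flow → Carrier
    flowValue f = outflow amount source - inflow amount source
      where open Flow f

    record Cut : Set where
      field
        sourceSide : Node → Bool
        source∈    : sourceSide source ≡ true
        sink∉      : sourceSide sink ≡ false

    cutValue : Cut → Carrier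
    cutValue C = sum λ e →
      if sourceSide (tail e) ∧ not (sourceSide (head e)) then capacity e else 0#
      where open Cut C

  IsMaxFlowValue : Network → Carrier → Set (c ⊔ ℓ₁ ⊔ ℓ₂)
  IsMaxFlowValue N = IsMaximum (Network.flowValue N)

  IsMinCutValue : Network → Carrier → Set (ℓ₁ ⊔ ℓ₂)
  IsMinCutValue N = IsMinimum (Network.cutValue N)

  record StepProfile (m : ℕ) : Set (c ⊔ ℓ₁ ⊔ ℓ₂) where
    field
      height   : Fin m → Carrier
      antitone : ∀ {i j} → i Fin.≤ j → height j ≤ height i
      positive : ∀ i → 0# < height i

  data Node (m : ℕ) : Set where
    s t : Node m
    X Y : (i j : Fin m) → Node m

  _≟ₙ_ : ∀ {m} → DecidableEquality (Node m)
  s     ≟ₙ s     = yes refl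
  s     ≟ₙ t     = no λ ()
  s     ≟ₙ X _ _ = no λ ()
  s     ≟ₙ Y _ _ = no λ ()
  t     ≟ₙ s     = no λ ()
  t     ≟ₙ t     = yes refl
  t     ≟ₙ X _ _ = no λ ()
  t     ≟ₙ Y _ _ = no λ ()
  X _ _ ≟ₙ s     = no λ ()
  X _ _ ≟ₙ t     = no λ ()
  X i j ≟ₙ X k l = map′ (λ { (refl , refl) → refl }) (λ { refl → refl , refl })
                        ((i Fin.≟ k) ×-dec (j Fin.≟ l))
  X _ _ ≟ₙ Y _ _ = no λ ()
  Y _ _ ≟ₙ s     = no λ ()
  Y _ _ ≟ₙ t     = no λ ()
  Y _ _ ≟ₙ X _ _ = no λ ()
  Y i j ≟ₙ Y k l = map′ (λ { (refl , refl) → refl }) (λ { refl → refl , refl })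
                        ((i Fin.≟ k) ×-dec (j Fin.≟ l))

  -- The index j ∈ {1, …, m} is the element of Fin m with toℕ equal to j - 1.
  -- The second index of g ranges over {1, …, m + 1} and is, in the same way, an
  -- element of Fin (suc m).  Thus for j : Fin m the columns j and j + 1 of g are
  -- inject₁ j and suc j.
  module Profile {m : ℕ} (profile : StepProfile m) where

    open StepProfile profile renaming (height to h)

    g : Fin m → Fin (suc m) → Carrier
    g i k with view k
    ... | ‵fromℕ     = 0#
    ... | ‵inject₁ j = h j / (h i + h j)

    q : Fin m → Fin m → Carrier
    q i j = g i (inject₁ j) - g i (suc j)

    -- The weights m - j + 1 and m - j, for the index j counted from 1.
    r : Fin m → Fin m → Carrier
    r i j = (m ∸ toℕ j) · g i (inject₁ j) - (m ∸ suc (toℕ j)) · g i (suc j)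

    infixl 7 _/m²
    _/m² : Carrier → Carrier
    x /m² = x / ((m ℕ.* m) · 1#)

    -- A threshold a ∈ {0, …, m} is the element of Fin (suc m) with toℕ equal to
    -- a.  In g it therefore denotes the column a + 1.
    Thresholds : Set
    Thresholds = Fin m → Fin (suc m)

    U : Thresholds → Fin m → Fin m → Carrier
    U a i j = indicator (toℕ (a i) ℕ.<? suc (toℕ j))

    Ṽ : Thresholds → Fin m → Fin m → Carrier
    Ṽ b i j = indicator (toℕ (b j) ℕ.<? suc (toℕ i))

    S : Thresholds → Thresholds → Fin m → Fin m → Carrier
    S a b i j = (1# - U a i j) * (1# - Ṽ b i j)

    P : Thresholds → Fin m → Carrier
    P a i = g i (a i)

    Q : Thresholds → Fin m → Carrier
    Q b j = g j (b j)

    𝒯 : Set ℓ₁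
    𝒯 = Σ[ (a , b) ∈ Thresholds × Thresholds ] (∀ i j → U a i j * Ṽ b i j ≈ 0#)

    Γ : 𝒯 → Carrier
    Γ ((a , b) , _) =
      (∑[ i < m ] ∑[ j < m ]
        (S a b i j + (U a i j + Ṽ b i j) * (P a i + Q b j))) /m²

    2# : Carrier
    2# = 1# + 1#

    -- At the index m + 1 there is no arc.
    arcAt : Fin (suc m) → (Fin m → Arc (Node m)) → List (Arc (Node m))
    arcAt k arc with view k
    ... | ‵fromℕ     = []
    ... | ‵inject₁ j = arc j ∷ []

    arcsAt : Fin m → Fin m → List (Arc (Node m))
    arcsAt i j =
         (s     ⟶ Y i j [ r j i /m² ])
      ∷  (Y i j ⟶ X i j [ 1# /m² ])
      ∷  (X i j ⟶ t     [ r i j /m² ])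
      ∷  (X i j ⟶ Y i j [ 2# ])
      ∷  map (λ k → X i j ⟶ Y i k [ q i j /m² ]) (allFin m)
      ++ map (λ k → X i j ⟶ Y k j [ q j k /m² ]) (allFin m)
      ++ arcAt (suc j) (λ j⁺ → X i j ⟶ X i j⁺ [ 2# ])
      ++ arcAt (suc i) (λ i⁺ → Y i⁺ j ⟶ Y i j [ 2# ])

    𝒩 : Network
    𝒩 = record
      { Node   = Node m
      ; _≟_    = _≟ₙ_
      ; source = s
      ; sink   = t
      ; arcs   = concatMap (λ i → concatMap (arcsAt i) (allFin m)) (allFin m)
      }

{-# OPTIONS --safe #-}

-- Max-flow min-cut holds over any ordered field by induction on the list of
-- arcs: a net demand D on node sets can be met as soon as D A never exceeds the
-- capacity leaving A.  Send along the first arc the largest excess of D A over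
-- what the remaining arcs carry out of A; submodularity of cut capacities shows
-- that the remaining demand still satisfies the condition.
--
-- A minimum cut of 𝒩 crosses no implication arc, since that would cost 2 while
-- the constant thresholds a = b = m cost 1.  Its source side is therefore
-- monotone along rows and columns, that is, given by a pair of thresholds, and
-- for such cuts the sums of q and r telescope to P and Q, which turns the cut
-- value into Γ.
module Submission where

open import Defs
import Algebra.Properties.Ring as RingProperties
import Algebra.Properties.Semiring.Mult as Mult
import Algebra.Properties.Semiring.Mult.TCOptimised as Multᵒ
import Algebra.Properties.Semiring.Sum as Sum
open import Algebra.Solver.Ring.AlmostCommutativeRing
  using (fromCommutativeRing; _-Raw-AlmostCommutative⟶_)
import Algebra.Solver.Ring
open import Data.Bool.Base using (Bool; true; false; if_then_else_; _∧_; _∨_; not)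
open import Data.Bool.Properties using (∧-zeroʳ; ∧-comm; not-involutive; ∧-inverseʳ; ∨-inverseʳ)
open import Data.Empty using (⊥-elim)
open import Data.Fin.Base as Fin using (Fin; zero; suc; toℕ; fromℕ; inject₁)
import Data.Fin.Properties as Fin
open import Data.Fin.Relation.Unary.Top using (view; view-fromℕ; view-inject₁; ‵fromℕ; ‵inject₁)
open import Data.Integer.Base as ℤ using (ℤ; +_; -[1+_]; +0)
import Data.Integer.Properties as ℤ
open import Data.List.Base as List using (List; []; _∷_; _++_; map; concatMap; allFin; length; lookup)
open import Data.List.Membership.Propositional using (_∈_; lose)
import Data.List.Membership.Propositional.Properties as ∈
open import Data.List.Relation.Unary.All as All using (All; []; _∷_)
import Data.List.Relation.Unary.All.Properties as All
open import Data.List.Relation.Unary.Any as Any using (here; there)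
import Data.List.Relation.Unary.Any.Properties as Any
open import Data.Maybe.Base using (Maybe; just; nothing)
open import Data.Nat.Base as ℕ using (ℕ; zero; suc; _∸_)
import Data.Nat.Properties as ℕ
open import Data.Product.Base using (∃-syntax; _×_; _,_; proj₁; proj₂)
open import Data.Sum.Base using (_⊎_; inj₁; inj₂)
import Data.Vec.Functional as Vector
import Level
open import Function.Base using (_∘_; id)
open import Relation.Binary.Bundles using (Poset)
import Relation.Binary.Reasoning.PartialOrder as PosetReasoning
import Relation.Binary.Reasoning.Setoid as SetoidReasoning
open import Relation.Binary.Definitions using (DecidableEquality)
open import Relation.Binary.PropositionalEquality as ≡ using (_≡_; _≢_; _≗_)
open import Relation.Binary.Structures using (IsDecTotalOrder)
open import Relation.Nullary.Decidable using (yes; no; does; dec-true; dec-false)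
open import Relation.Nullary.Negation using (¬_)

-- Over an arbitrary ordered field no limit or compactness argument is available. What is finite is
-- the collection of node sets, so every optimum is found by comparing values on it. A source-sink
-- demand does not survive the removal of an arc, hence the general demand `D`. It is a modular set
-- function and not a vector indexed by nodes, so that conservation and cut bounds need no sums over
-- nodes.
--
-- For a threshold cut the arc families match the terms of the payoff: `s` to `Y` gives Ṽ Q, `Y` to
-- `X` gives S, `X` to `t` gives U P, `X i j` to `Y i k` gives Ṽ P and `X i j` to `Y k j` gives U Q.
-- In general the match holds only after summation over all pairs (i, j). The constraint U Ṽ = 0
-- says that no arc `X i j` to `Y i j` of capacity 2 is crossed. Nonnegativity of q and r comes from
-- the monotonicity of y / (x + y) in y.

module OrderedFieldProperties {c ℓ₁ ℓ₂} (K : OrderedField c ℓ₁ ℓ₂) where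

  open OrderedField K hiding (zero)
  open IsDecTotalOrder isDecTotalOrder public
    using (antisym; isPartialOrder)
    renaming (total to ≤-total; refl to ≤-refl; reflexive to ≤-reflexive; trans to ≤-trans)
  open RingProperties ring using (-‿distribˡ-*; -‿distribʳ-*; -0#≈0#; -‿involutive; -‿+-comm)
  open Mult semiring using () renaming (_×_ to _·_)
  open Multᵒ semiring using (1+×; ×-homo-+; ×1-homo-*) renaming (_×_ to _·ᵒ_)
  open Sum semiring

  poset : Poset c ℓ₁ ℓ₂
  poset = record { isPartialOrder = isPartialOrder }

  χ : Bool → Carrier
  χ b = if b then 1# else 0#

  -- Integer coefficients for the ring solver.

  private module Solver where

    open SetoidReasoning setoid

    -- The optimised multiple makes the coefficient 1 evaluate to 1# itself
    -- rather than to 1# + 0#.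
    ⟦_⟧ : ℤ → Carrier
    ⟦ + n ⟧      = n ·ᵒ 1#
    ⟦ -[1+ n ] ⟧ = - (suc n ·ᵒ 1#)

    ⟦-⟧ : ∀ i → ⟦ ℤ.- i ⟧ ≈ - ⟦ i ⟧
    ⟦-⟧ (+ zero)   = sym -0#≈0#
    ⟦-⟧ (+ suc n)  = refl
    ⟦-⟧ -[1+ n ]   = sym (-‿involutive _)

    -- Proved by hand: the solver exists only once the coefficient morphism, which rests on this
    -- identity, has been built.
    cancel-common : ∀ x y z → (x + y) - (x + z) ≈ y - z
    cancel-common x y z = begin
      (x + y) - (x + z)        ≈⟨ +-cong (+-comm x y) (sym (-‿+-comm x z)) ⟩
      (y + x) + (- x - z)      ≈⟨ +-assoc y x _ ⟩
      y + (x + (- x - z))      ≈⟨ +-congˡ (sym (+-assoc x (- x) _)) ⟩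
      y + ((x - x) - z)        ≈⟨ +-congˡ (+-congʳ (-‿inverseʳ x)) ⟩
      y + (0# - z)             ≈⟨ +-congˡ (+-identityˡ _) ⟩
      y - z                    ∎

    ⟦⊖⟧ : ∀ m n → ⟦ m ℤ.⊖ n ⟧ ≈ m ·ᵒ 1# - n ·ᵒ 1#
    ⟦⊖⟧ m zero = sym (trans (+-congˡ -0#≈0#) (+-identityʳ _))
    ⟦⊖⟧ zero (suc n) = sym (+-identityˡ _)
    ⟦⊖⟧ (suc m) (suc n) = begin
      ⟦ suc m ℤ.⊖ suc n ⟧                   ≡⟨ ≡.cong ⟦_⟧ (ℤ.[1+m]⊖[1+n]≡m⊖n m n) ⟩
      ⟦ m ℤ.⊖ n ⟧                           ≈⟨ ⟦⊖⟧ m n ⟩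
      m ·ᵒ 1# - n ·ᵒ 1#                     ≈⟨ cancel-common 1# _ _ ⟨
      (1# + m ·ᵒ 1#) - (1# + n ·ᵒ 1#)       ≈⟨ +-cong (1+× m 1#) (-‿cong (1+× n 1#)) ⟨
      suc m ·ᵒ 1# - suc n ·ᵒ 1#             ∎

    ⟦+⟧ : ∀ i j → ⟦ i ℤ.+ j ⟧ ≈ ⟦ i ⟧ + ⟦ j ⟧
    ⟦+⟧ (+ m)    (+ n)    = ×-homo-+ 1# m n
    ⟦+⟧ (+ m)    -[1+ n ] = ⟦⊖⟧ m (suc n)
    ⟦+⟧ -[1+ m ] (+ n)    = trans (⟦⊖⟧ n (suc m)) (+-comm _ _)
    ⟦+⟧ -[1+ m ] -[1+ n ] = begin
      - (suc (suc (m ℕ.+ n)) ·ᵒ 1#)          ≡⟨ ≡.cong (λ k → - (suc k ·ᵒ 1#)) (ℕ.+-suc m n) ⟨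
      - ((suc m ℕ.+ suc n) ·ᵒ 1#)            ≈⟨ -‿cong (×-homo-+ 1# (suc m) (suc n)) ⟩
      - (suc m ·ᵒ 1# + suc n ·ᵒ 1#)          ≈⟨ -‿+-comm _ _ ⟨
      - (suc m ·ᵒ 1#) - suc n ·ᵒ 1#          ∎

    ⟦pos*pos⟧ : ∀ m n → ⟦ + m ℤ.* + n ⟧ ≈ ⟦ + m ⟧ * ⟦ + n ⟧
    ⟦pos*pos⟧ m n = trans (reflexive (≡.cong ⟦_⟧ (≡.sym (ℤ.pos-* m n)))) (×1-homo-* m n)

    ⟦pos*⟧ : ∀ m j → ⟦ + m ℤ.* j ⟧ ≈ ⟦ + m ⟧ * ⟦ j ⟧
    ⟦pos*⟧ m (+ n)    = ⟦pos*pos⟧ m n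
    ⟦pos*⟧ m -[1+ n ] = begin
      ⟦ + m ℤ.* (ℤ.- + suc n) ⟧  ≡⟨ ≡.cong ⟦_⟧ (ℤ.neg-distribʳ-* (+ m) (+ suc n)) ⟨
      ⟦ ℤ.- (+ m ℤ.* + suc n) ⟧  ≈⟨ ⟦-⟧ (+ m ℤ.* + suc n) ⟩
      - ⟦ + m ℤ.* + suc n ⟧      ≈⟨ -‿cong (⟦pos*pos⟧ m (suc n)) ⟩
      - (⟦ + m ⟧ * ⟦ + suc n ⟧)  ≈⟨ -‿distribʳ-* _ _ ⟩
      ⟦ + m ⟧ * - ⟦ + suc n ⟧    ∎

    ⟦*⟧ : ∀ i j → ⟦ i ℤ.* j ⟧ ≈ ⟦ i ⟧ * ⟦ j ⟧
    ⟦*⟧ (+ m)    j = ⟦pos*⟧ m j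
    ⟦*⟧ -[1+ m ] j = begin
      ⟦ (ℤ.- + suc m) ℤ.* j ⟧  ≡⟨ ≡.cong ⟦_⟧ (ℤ.neg-distribˡ-* (+ suc m) j) ⟨
      ⟦ ℤ.- (+ suc m ℤ.* j) ⟧  ≈⟨ ⟦-⟧ (+ suc m ℤ.* j) ⟩
      - ⟦ + suc m ℤ.* j ⟧      ≈⟨ -‿cong (⟦pos*⟧ (suc m) j) ⟩
      - (⟦ + suc m ⟧ * ⟦ j ⟧)  ≈⟨ -‿distribˡ-* _ _ ⟩
      - ⟦ + suc m ⟧ * ⟦ j ⟧    ∎

    morphism : ℤ.+-*-rawRing -Raw-AlmostCommutative⟶ fromCommutativeRing commutativeRing
    morphism = record
      { ⟦_⟧    = ⟦_⟧
      ; +-homo = ⟦+⟧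
      ; *-homo = ⟦*⟧
      ; -‿homo = ⟦-⟧
      ; 0-homo = refl
      ; 1-homo = refl
      }

    _coeff≟_ : ∀ i j → Maybe (⟦ i ⟧ ≈ ⟦ j ⟧)
    i coeff≟ j with i ℤ.≟ j
    ... | yes i≡j = just (reflexive (≡.cong ⟦_⟧ i≡j))
    ... | no  _   = nothing

  open Algebra.Solver.Ring ℤ.+-*-rawRing (fromCommutativeRing commutativeRing)
    Solver.morphism Solver._coeff≟_ public
    using (solve; _:=_; _:+_; _:*_; _:-_; :-_; con)

  -- Order and inverses.

  open PosetReasoning poset

  -- The working form of most inequalities below: an explicit nonnegative difference `d` is
  -- supplied, and what remains is a ring identity for the solver.
  x+d≤ : ∀ {x y d} → 0# ≤ d → y ≈ x + d → x ≤ y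
  x+d≤ {x} {y} {d} 0≤d y≈x+d = begin
    x       ≈⟨ +-identityʳ x ⟨
    x + 0#  ≤⟨ +-monoʳ-≤ x 0≤d ⟩
    x + d   ≈⟨ y≈x+d ⟨
    y       ∎

  x≤y⇒0≤y-x : ∀ {x y} → x ≤ y → 0# ≤ y - x
  x≤y⇒0≤y-x {x} {y} x≤y = begin
    0#       ≈⟨ -‿inverseˡ x ⟨
    - x + x  ≤⟨ +-monoʳ-≤ (- x) x≤y ⟩
    - x + y  ≈⟨ +-comm (- x) y ⟩
    y - x    ∎

  +-mono-≤ : ∀ {w x y z} → w ≤ x → y ≤ z → w + y ≤ x + z
  +-mono-≤ {w} {x} {y} {z} w≤x y≤z = begin
    w + y  ≤⟨ +-monoʳ-≤ w y≤z ⟩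
    w + z  ≈⟨ +-comm w z ⟩
    z + w  ≤⟨ +-monoʳ-≤ z w≤x ⟩
    z + x  ≈⟨ +-comm z x ⟩
    x + z  ∎

  +-nonNegative : ∀ {x y} → 0# ≤ x → 0# ≤ y → 0# ≤ x + y
  +-nonNegative 0≤x 0≤y = ≤-trans (≤-reflexive (sym (+-identityʳ 0#))) (+-mono-≤ 0≤x 0≤y)

  ·-nonNegative : ∀ n {x} → 0# ≤ x → 0# ≤ n · x
  ·-nonNegative zero    0≤x = ≤-refl
  ·-nonNegative (suc n) 0≤x = +-nonNegative 0≤x (·-nonNegative n 0≤x)

  ·-monoʳ-≤ : ∀ n {x y} → x ≤ y → n · x ≤ n · y
  ·-monoʳ-≤ zero    x≤y = ≤-refl
  ·-monoʳ-≤ (suc n) x≤y = +-mono-≤ x≤y (·-monoʳ-≤ n x≤y)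

  sum-mono-≤ : ∀ {n} {x y : Fin n → Carrier} → (∀ i → x i ≤ y i) → sum x ≤ sum y
  sum-mono-≤ {zero}  x≤y = ≤-refl
  sum-mono-≤ {suc n} x≤y = +-mono-≤ (x≤y zero) (sum-mono-≤ (x≤y ∘ suc))

  sum-nonNegative : ∀ {n} {x : Fin n → Carrier} → (∀ i → 0# ≤ x i) → 0# ≤ sum x
  sum-nonNegative {zero}  0≤x = ≤-refl
  sum-nonNegative {suc n} 0≤x = +-nonNegative (0≤x zero) (sum-nonNegative (0≤x ∘ suc))

  term≤sum : ∀ {n} {x : Fin n → Carrier} → (∀ i → 0# ≤ x i) → ∀ i → x i ≤ sum x
  term≤sum {suc n} 0≤x zero    = x+d≤ (sum-nonNegative (0≤x ∘ suc)) refl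
  term≤sum {suc n} 0≤x (suc i) =
    ≤-trans (term≤sum (0≤x ∘ suc) i) (x+d≤ (0≤x zero) (+-comm _ _))

  -- If 1 ≤ 0 then 0 - 1 is nonnegative, and so is its square, which is 1.
  0≤1 : 0# ≤ 1#
  0≤1 with ≤-total 0# 1#
  ... | inj₁ 0≤1 = 0≤1
  ... | inj₂ 1≤0 = begin
    0#                     ≤⟨ *-nonNegative (x≤y⇒0≤y-x 1≤0) (x≤y⇒0≤y-x 1≤0) ⟩
    (0# - 1#) * (0# - 1#)  ≈⟨ solve 0 ((con +0 :- con (+ 1)) :* (con +0 :- con (+ 1)) := con (+ 1)) refl ⟩
    1#                     ∎

  1≰0 : ¬ 1# ≤ 0#
  1≰0 1≤0 = 0≉1 (antisym 0≤1 1≤0)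

  0<⇒≉0 : ∀ {x} → 0# < x → x ≉ 0#
  0<⇒≉0 (_ , 0≉x) x≈0 = 0≉x (sym x≈0)

  -- If the inverse were at most 0, then x * (0 - x⁻¹) would be nonnegative, and adding it to 1 = x
  -- * x⁻¹ would give 1 ≤ 0.
  ⁻¹-nonNegative : ∀ {x} → 0# < x → 0# ≤ x ⁻¹
  ⁻¹-nonNegative {x} 0<x with ≤-total 0# (x ⁻¹)
  ... | inj₁ 0≤x⁻¹ = 0≤x⁻¹
  ... | inj₂ x⁻¹≤0 = ⊥-elim (1≰0 (begin
    1#                          ≤⟨ x+d≤ (*-nonNegative (proj₁ 0<x) (x≤y⇒0≤y-x x⁻¹≤0)) refl ⟩
    1# + x * (0# - x ⁻¹)        ≈⟨ +-congʳ (⁻¹-inverseʳ x (0<⇒≉0 0<x)) ⟨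
    x * x ⁻¹ + x * (0# - x ⁻¹)  ≈⟨ solve 2 (λ x y → x :* y :+ x :* (con +0 :- y) := con +0) refl x (x ⁻¹) ⟩
    0#                          ∎))

  +-positive : ∀ {x y} → 0# < x → 0# ≤ y → 0# < x + y
  +-positive {x} {y} (0≤x , 0≉x) 0≤y = +-nonNegative 0≤x 0≤y ,
    λ 0≈x+y → 0≉x (antisym 0≤x (x+d≤ 0≤y 0≈x+y))

  ·1-positive : ∀ {n} → 1 ℕ.≤ n → 0# < n · 1#
  ·1-positive {suc n} _ = +-positive (0≤1 , 0≉1) (·-nonNegative n 0≤1)

-- Node sets and net demands.

module Supplies {c ℓ₁ ℓ₂} (K : OrderedField c ℓ₁ ℓ₂) {Node : Set}
  (_≟_ : DecidableEquality Node) (nodes : List Node) (∈-nodes : ∀ v → v ∈ nodes) where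

  open OrderedField K hiding (zero)
  open OrderedFieldProperties K
  open Over K using (Arc; _⟶_[_])
  open Sum semiring
  open PosetReasoning poset

  Subset : Set
  Subset = Node → Bool

  ∅ full : Subset
  ∅    _ = false
  full _ = true

  infixr 7 _∩_
  infixr 6 _∪_
  _∩_ _∪_ : Subset → Subset → Subset
  (A ∩ B) v = A v ∧ B v
  (A ∪ B) v = A v ∨ B v

  singleton : Node → Subset
  singleton v w = does (w ≟ v)

  infix 8 _[_≔_]
  _[_≔_] : Subset → Node → Bool → Subset
  (A [ v ≔ b ]) w = if does (w ≟ v) then b else A w

  ≔-updated : ∀ A v b → (A [ v ≔ b ]) v ≡ b
  ≔-updated A v b with v ≟ v
  ... | yes _   = ≡.refl
  ... | no  v≢v = ⊥-elim (v≢v ≡.refl)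

  ≔-id : ∀ A v {b} → A v ≡ b → A [ v ≔ b ] ≗ A
  ≔-id A v Av≡b w with w ≟ v
  ... | yes ≡.refl = ≡.sym Av≡b
  ... | no  _      = ≡.refl

  ≔-cong : ∀ {A B} v b → A ≗ B → A [ v ≔ b ] ≗ B [ v ≔ b ]
  ≔-cong v b A≗B w with w ≟ v
  ... | yes _ = ≡.refl
  ... | no  _ = A≗B w

  Maximiser : (Subset → Carrier) → Set ℓ₂
  Maximiser F = ∃[ A ] ∀ B → F B ≤ F A

  -- Induction on the list of nodes that `F` depends on: the first node is put inside or outside,
  -- and the better of the two maxima is kept. For the empty list `F` is constant. The dependence is
  -- an explicit hypothesis because pointwise equal subsets need not be propositionally equal.
  maximiser-on : ∀ L F → (∀ {A B} → (∀ {v} → v ∈ L → A v ≡ B v) → F A ≈ F B) → Maximiser F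
  maximiser-on []      F local = ∅ , λ B → ≤-reflexive (local λ ())
  maximiser-on (w ∷ L) F local = choose (≤-total (F A₁) (F A₀))
    where
    local′ : ∀ b {A B} → (∀ {v} → v ∈ L → A v ≡ B v) → F (A [ w ≔ b ]) ≈ F (B [ w ≔ b ])
    local′ b {A} {B} A≡B = local λ { {v} v∈ → agree v v∈ }
      where
      agree : ∀ v → v ∈ w ∷ L → (A [ w ≔ b ]) v ≡ (B [ w ≔ b ]) v
      agree v v∈         with v ≟ w
      agree v v∈         | yes _   = ≡.refl
      agree v (here v≡w) | no  v≢w = ⊥-elim (v≢w v≡w)
      agree v (there v∈) | no  _   = A≡B v∈

    max₁ : Maximiser (λ A → F (A [ w ≔ true ]))
    max₁ = maximiser-on L _ (local′ true)

    max₀ : Maximiser (λ A → F (A [ w ≔ false ]))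
    max₀ = maximiser-on L _ (local′ false)

    A₁ A₀ : Subset
    A₁ = proj₁ max₁ [ w ≔ true ]
    A₀ = proj₁ max₀ [ w ≔ false ]

    bound : ∀ {A} → F A₁ ≤ F A → F A₀ ≤ F A → ∀ B → F B ≤ F A
    bound A₁≤ A₀≤ B with B w in Bw
    ... | true  = ≤-trans (≤-reflexive (local λ {v} _ → ≡.sym (≔-id B w Bw v)))
                          (≤-trans (proj₂ max₁ B) A₁≤)
    ... | false = ≤-trans (≤-reflexive (local λ {v} _ → ≡.sym (≔-id B w Bw v)))
                          (≤-trans (proj₂ max₀ B) A₀≤)

    choose : F A₁ ≤ F A₀ ⊎ F A₀ ≤ F A₁ → Maximiser F
    choose (inj₁ A₁≤A₀) = A₀ , bound A₁≤A₀ ≤-refl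
    choose (inj₂ A₀≤A₁) = A₁ , bound ≤-refl A₀≤A₁

  maximiser : ∀ F → (∀ {A B} → A ≗ B → F A ≈ F B) → Maximiser F
  maximiser F F-cong = maximiser-on nodes F λ A≡B → F-cong λ v → A≡B (∈-nodes v)

  χ-modular : ∀ a b → χ a + χ b ≈ χ (a ∧ b) + χ (a ∨ b)
  χ-modular false b     = refl
  χ-modular true  false = +-comm 1# 0#
  χ-modular true  true  = refl

  -- One unit of flow from `u` to `v` as seen from `A`: 1 if it leaves `A`, -1 if it enters, 0
  -- otherwise.
  ∂ : Node → Node → Subset → Carrier
  ∂ u v A = χ (A u) - χ (A v)

  -- D A is the net amount which has to leave the node set A.
  record Balanced (D : Subset → Carrier) : Set (c Level.⊔ ℓ₁) where
    field
      cong    : ∀ {A B} → A ≗ B → D A ≈ D B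
      empty   : D ∅ ≈ 0#
      all     : D full ≈ 0#
      modular : ∀ A B → D A + D B ≈ D (A ∩ B) + D (A ∪ B)

  zero-balanced : Balanced (λ _ → 0#)
  zero-balanced = record
    { cong = λ _ → refl ; empty = refl ; all = refl ; modular = λ _ _ → refl }

  ∂-balanced : ∀ {D} → Balanced D → ∀ x u v → Balanced (λ A → x * ∂ u v A + D A)
  ∂-balanced {D} bal x u v = record
    { cong    = λ {A} {B} A≗B → +-cong (*-congˡ (reflexive
                  (≡.cong₂ (λ a b → χ a - χ b) (A≗B u) (A≗B v)))) (cong A≗B)
    ; empty   = trans (+-congˡ empty) (solve 1 (λ x → x :* (con +0 :- con +0) :+ con +0 := con +0) refl x)
    ; all     = trans (+-congˡ all) (solve 1 (λ x → x :* (con (+ 1) :- con (+ 1)) :+ con +0 := con +0) refl x)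
    ; modular = λ A B → begin-equality
        (x * ∂ u v A + D A) + (x * ∂ u v B + D B)
          ≈⟨ expand (χ (A u)) (χ (B u)) (χ (A v)) (χ (B v)) (D A) (D B) ⟩
        x * ((χ (A u) + χ (B u)) - (χ (A v) + χ (B v))) + (D A + D B)
          ≈⟨ +-cong (*-congˡ (+-cong (χ-modular (A u) (B u)) (-‿cong (χ-modular (A v) (B v)))))
                    (modular A B) ⟩
        x * ((χ ((A ∩ B) u) + χ ((A ∪ B) u)) - (χ ((A ∩ B) v) + χ ((A ∪ B) v))) + (D (A ∩ B) + D (A ∪ B))
          ≈⟨ expand (χ ((A ∩ B) u)) (χ ((A ∪ B) u)) (χ ((A ∩ B) v)) (χ ((A ∪ B) v)) (D (A ∩ B)) (D (A ∪ B)) ⟨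
        (x * ∂ u v (A ∩ B) + D (A ∩ B)) + (x * ∂ u v (A ∪ B) + D (A ∪ B)) ∎
    }
    where
    open Balanced bal
    expand : ∀ a b a′ b′ d e → (x * (a - a′) + d) + (x * (b - b′) + e) ≈
                               x * ((a + b) - (a′ + b′)) + (d + e)
    expand = solve 7 (λ x a b a′ b′ d e → (x :* (a :- a′) :+ d) :+ (x :* (b :- b′) :+ e) :=
                               x :* ((a :+ b) :- (a′ :+ b′)) :+ (d :+ e)) refl x

  -- Modularity applied to the node and the rest of `A`, whose intersection is empty. This takes the
  -- place of splitting a sum over nodes.
  removal : ∀ {D} → Balanced D → ∀ {A v} → A v ≡ true → D A ≈ D (singleton v) + D (A [ v ≔ false ])
  removal {D} bal {A} {v} Av = sym (begin-equality
    D (singleton v) + D A′                      ≈⟨ modular _ _ ⟩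
    D (singleton v ∩ A′) + D (singleton v ∪ A′) ≈⟨ +-cong (cong disjoint) (cong union) ⟩
    D ∅ + D A                                   ≈⟨ +-congʳ empty ⟩
    0# + D A                                    ≈⟨ +-identityˡ _ ⟩
    D A                                         ∎)
    where
    open Balanced bal
    A′ : Subset
    A′ = A [ v ≔ false ]
    disjoint : singleton v ∩ A′ ≗ ∅
    disjoint w with w ≟ v
    ... | yes _ = ≡.refl
    ... | no  _ = ≡.refl
    union : singleton v ∪ A′ ≗ A
    union w with w ≟ v
    ... | yes ≡.refl = ≡.sym Av
    ... | no  _      = ≡.refl

  -- Nodes are removed one at a time; `go` keeps the invariant that the list still covers `A`. It
  -- serves to sum flow conservation over a set of inner nodes.
  vanishing : ∀ {D} → Balanced D → ∀ {A} → (∀ v → A v ≡ true → D (singleton v) ≈ 0#) → D A ≈ 0#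
  vanishing {D} bal = go nodes λ v _ → ∈-nodes v
    where
    open Balanced bal
    go : ∀ L {A} → (∀ v → A v ≡ true → v ∈ L) → (∀ v → A v ≡ true → D (singleton v) ≈ 0#) → D A ≈ 0#
    go [] {A} A⊆L _ = trans (cong outside) empty
      where
      outside : A ≗ ∅
      outside v with A v in Av
      ... | false = ≡.refl
      ... | true with A⊆L v Av
      ...   | ()
    go (w ∷ L) {A} A⊆L D≈0 with A w in Aw
    ... | false = go L smaller D≈0
      where
      smaller : ∀ v → A v ≡ true → v ∈ L
      smaller v Av with A⊆L v Av
      ... | there v∈L = v∈L
      ... | here ≡.refl with ≡.trans (≡.sym Av) Aw
      ...   | ()
    ... | true = begin-equality
      D A                                    ≈⟨ removal bal Aw ⟩
      D (singleton w) + D (A [ w ≔ false ])  ≈⟨ +-cong (D≈0 w Aw) (go L smaller λ v v∈ → D≈0 v (A′⊆A v v∈)) ⟩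
      0# + 0#                                ≈⟨ +-identityˡ 0# ⟩
      0#                                     ∎
      where
      A′⊆A : ∀ v → (A [ w ≔ false ]) v ≡ true → A v ≡ true
      A′⊆A v v∈ with v ≟ w
      ... | no _ = v∈
      ... | yes _ with v∈
      ...   | ()
      smaller : ∀ v → (A [ w ≔ false ]) v ≡ true → v ∈ L
      smaller v v∈ with A⊆L v (A′⊆A v v∈)
      ... | there v∈L = v∈L
      ... | here ≡.refl with ≡.trans (≡.sym v∈) (≔-updated A w false)
      ...   | ()

  -- Cut capacities, and flows that meet a demand.

  crossing : Arc Node → Subset → Carrier
  crossing a A = if A (Arc.tail a) ∧ not (A (Arc.head a)) then Arc.capacity a else 0#

  cutCapacity : List (Arc Node) → Subset → Carrier
  cutCapacity as A = sum λ e → crossing (lookup as e) A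

  net : (as : List (Arc Node)) → (Fin (length as) → Carrier) → Subset → Carrier
  net as f A = sum λ e → f e * ∂ (Arc.tail (lookup as e)) (Arc.head (lookup as e)) A

  net-balanced : ∀ as f → Balanced (net as f)
  net-balanced []       f = zero-balanced
  net-balanced (a ∷ as) f = ∂-balanced (net-balanced as (f ∘ suc)) (f zero) _ _

  crossing-cong : ∀ a {A B} → A ≗ B → crossing a A ≈ crossing a B
  crossing-cong a A≗B = reflexive (≡.cong₂ (λ p q → if p ∧ not q then Arc.capacity a else 0#)
    (A≗B (Arc.tail a)) (A≗B (Arc.head a)))

  cutCapacity-cong : ∀ as {A B} → A ≗ B → cutCapacity as A ≈ cutCapacity as B
  cutCapacity-cong as A≗B = sum-cong-≋ λ e → crossing-cong (lookup as e) A≗B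

  NonNegative : List (Arc Node) → Set (c Level.⊔ ℓ₂)
  NonNegative = All (λ a → 0# ≤ Arc.capacity a)

  crossing-nonNegative : ∀ a → 0# ≤ Arc.capacity a → ∀ A → 0# ≤ crossing a A
  crossing-nonNegative a 0≤c A with A (Arc.tail a) ∧ not (A (Arc.head a))
  ... | true  = 0≤c
  ... | false = ≤-refl

  cutCapacity-nonNegative : ∀ {as} → NonNegative as → ∀ A → 0# ≤ cutCapacity as A
  cutCapacity-nonNegative {as} 0≤c A =
    sum-nonNegative λ e → crossing-nonNegative (lookup as e) (All.lookup 0≤c (∈.∈-lookup e)) A

  -- The two sides agree except for an arc between a node of `A` outside `B` and a node of `B`
  -- outside `A`, in either direction: it counts once on the right and not at all on the left.
  crossing-submodular : ∀ a → 0# ≤ Arc.capacity a → ∀ A B →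
    crossing a (A ∩ B) + crossing a (A ∪ B) ≤ crossing a A + crossing a B
  crossing-submodular a 0≤c A B =
    cases (A (Arc.tail a)) (A (Arc.head a)) (B (Arc.tail a)) (B (Arc.head a))
    where
    w : Bool → Bool → Carrier
    w p q = if p ∧ not q then Arc.capacity a else 0#
    0≤w : ∀ p q → 0# ≤ w p q
    0≤w false q     = ≤-refl
    0≤w true  false = 0≤c
    0≤w true  true  = ≤-refl
    swap : ∀ {x y} → x + y ≤ y + x
    swap = ≤-reflexive (+-comm _ _)
    cases : ∀ p q p′ q′ → w (p ∧ p′) (q ∧ q′) + w (p ∨ p′) (q ∨ q′) ≤ w p q + w p′ q′
    cases false false p′    q′    = ≤-refl
    cases false true  true  q′    = +-mono-≤ ≤-refl (0≤w true q′)
    cases false true  false q′    = ≤-refl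
    cases true  true  p′    q′    = swap
    cases true  false true  q′    = ≤-refl
    cases true  false false false = swap
    cases true  false false true  = +-mono-≤ 0≤c ≤-refl

  cutCapacity-submodular : ∀ {as} → NonNegative as → ∀ A B →
    cutCapacity as (A ∩ B) + cutCapacity as (A ∪ B) ≤ cutCapacity as A + cutCapacity as B
  cutCapacity-submodular {as} 0≤c A B = begin
    cutCapacity as (A ∩ B) + cutCapacity as (A ∪ B)
      ≈⟨ ∑-distrib-+ (λ e → crossing (lookup as e) (A ∩ B)) _ ⟨
    (sum λ e → crossing (lookup as e) (A ∩ B) + crossing (lookup as e) (A ∪ B))
      ≤⟨ sum-mono-≤ (λ e → crossing-submodular (lookup as e) (All.lookup 0≤c (∈.∈-lookup e)) A B) ⟩
    (sum λ e → crossing (lookup as e) A + crossing (lookup as e) B)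
      ≈⟨ ∑-distrib-+ (λ e → crossing (lookup as e) A) _ ⟩
    cutCapacity as A + cutCapacity as B ∎

  module FirstArc (u v : Node) {cap : Carrier} (0≤cap : 0# ≤ cap)
    {as : List (Arc Node)} (0≤caps : NonNegative as) {D : Subset → Carrier} (bal : Balanced D)
    (D≤ : ∀ A → D A ≤ cutCapacity ((u ⟶ v [ cap ]) ∷ as) A) where

    open Balanced bal

    -- The amount which the remaining arcs cannot carry out of A.
    excess : Subset → Carrier
    excess A = if A u ∧ not (A v) then D A - cutCapacity as A else 0#

    excess-cong : ∀ {A B} → A ≗ B → excess A ≈ excess B
    excess-cong {A} {B} A≗B rewrite A≗B u | A≗B v with B u ∧ not (B v)
    ... | true  = +-cong (cong A≗B) (-‿cong (cutCapacity-cong as A≗B))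
    ... | false = refl

    D≤-uncrossed : ∀ A → A u ∧ not (A v) ≡ false → D A ≤ cutCapacity as A
    D≤-uncrossed A uncrossed with A u ∧ not (A v) | D≤ A
    ... | false | D≤ = ≤-trans D≤ (≤-reflexive (+-identityˡ _))

    excess≤cap : ∀ A → excess A ≤ cap
    excess≤cap A with A u ∧ not (A v) | D≤ A
    ... | false | _  = 0≤cap
    ... | true  | D≤ = x+d≤ (x≤y⇒0≤y-x D≤)
      (solve 3 (λ c k d → c := (d :- k) :+ ((c :+ k) :- d)) refl cap (cutCapacity as A) (D A))

    -- Uncrossing: A ∩ B and A ∪ B do not separate u from v.
    excess-opposite : ∀ A B → B u ≡ false → B v ≡ true → excess A + D B ≤ cutCapacity as B
    excess-opposite A B Bu Bv with A u in Au | A v in Av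
    ... | false | _    = ≤-trans (≤-reflexive (+-identityˡ _))
                           (D≤-uncrossed B (≡.cong (_∧ not (B v)) Bu))
    ... | true  | true = ≤-trans (≤-reflexive (+-identityˡ _))
                           (D≤-uncrossed B (≡.cong (_∧ not (B v)) Bu))
    ... | true  | false = x+d≤
      (+-nonNegative (x≤y⇒0≤y-x D≤′) (x≤y⇒0≤y-x (cutCapacity-submodular 0≤caps A B)))
      (trans (solve 5 (λ kA kB k∩ k∪ d →
                 kB := ((:- kA :+ d) :+ (((k∩ :+ k∪) :- d) :+ ((kA :+ kB) :- (k∩ :+ k∪))))) refl
               (cutCapacity as A) (cutCapacity as B) (cutCapacity as (A ∩ B)) (cutCapacity as (A ∪ B))
               (D (A ∩ B) + D (A ∪ B)))
             (+-congʳ (trans (+-congˡ (sym (modular A B)))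
               (solve 3 (λ kA dA dB → :- kA :+ (dA :+ dB) := (dA :- kA) :+ dB) refl
                 (cutCapacity as A) (D A) (D B)))))
      where
      D≤′ : D (A ∩ B) + D (A ∪ B) ≤ cutCapacity as (A ∩ B) + cutCapacity as (A ∪ B)
      D≤′ = +-mono-≤
        (D≤-uncrossed (A ∩ B) (≡.cong₂ (λ p q → (p ∧ q) ∧ not ((A ∩ B) v)) Au Bu))
        (D≤-uncrossed (A ∪ B) (≡.trans (≡.cong (λ p → (A ∪ B) u ∧ not (p ∨ B v)) Av)
          (≡.trans (≡.cong (λ q → (A ∪ B) u ∧ not q) Bv) (∧-zeroʳ ((A ∪ B) u)))))

    -- A set containing `u` but not `v` forces at least its excess through the arc. The largest
    -- excess is thus the least admissible amount, which leaves the most room for the sets that the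
    -- arc enters.
    A* : Maximiser excess
    A* = maximiser excess excess-cong

    amount : Carrier
    amount = excess (proj₁ A*)

    0≤amount : 0# ≤ amount
    -- `excess ∅` is the default value 0, since `∅` does not contain `u`.
    0≤amount = proj₂ A* ∅

    amount≤cap : amount ≤ cap
    amount≤cap = excess≤cap (proj₁ A*)

    rest : Subset → Carrier
    rest A = - amount * ∂ u v A + D A

    -- A set that does not separate `u` from `v` sees neither the arc nor the change of demand. If
    -- the arc leaves the set, maximality of `amount` suffices. If the arc enters it, the demand
    -- grows by `amount`, and uncrossing against the maximiser applies.
    rest≤ : ∀ A → rest A ≤ cutCapacity as A
    rest≤ A with A u in Au | A v in Av | proj₂ A* A
    ... | true  | true  | _ = ≤-trans
      (≤-reflexive (solve 2 (λ x d → (:- x) :* (con (+ 1) :- con (+ 1)) :+ d := d) refl amount (D A)))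
      (D≤-uncrossed A (≡.cong₂ (λ p q → p ∧ not q) Au Av))
    ... | false | false | _ = ≤-trans
      (≤-reflexive (solve 2 (λ x d → (:- x) :* (con +0 :- con +0) :+ d := d) refl amount (D A)))
      (D≤-uncrossed A (≡.cong₂ (λ p q → p ∧ not q) Au Av))
    ... | false | true  | _ = ≤-trans
      (≤-reflexive (solve 2 (λ x d → (:- x) :* (con +0 :- con (+ 1)) :+ d := x :+ d) refl amount (D A)))
      (excess-opposite (proj₁ A*) A Au Av)
    ... | true  | false | excess≤ = x+d≤ (x≤y⇒0≤y-x excess≤)
      (solve 3 (λ x d k → k := ((:- x) :* (con (+ 1) :- con +0) :+ d) :+ (x :- (d :- k))) refl
        amount (D A) (cutCapacity as A))

  -- A feasibility theorem in the manner of Gale. `D` has to range over all balanced demands: after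
  -- the flow on the first arc is subtracted, its two end nodes carry demand of their own.
  supply : ∀ as → NonNegative as → ∀ {D} → Balanced D → (∀ A → D A ≤ cutCapacity as A) →
    ∃[ f ] (∀ e → 0# ≤ f e) × (∀ e → f e ≤ Arc.capacity (lookup as e)) × (∀ A → net as f A ≈ D A)
  supply [] _ {D} bal D≤ = (λ ()) , (λ ()) , (λ ()) , λ A → antisym (0≤D A) (D≤ A)
    where
    open Balanced bal
    -- With no arcs the hypothesis reads D ≤ 0. Applied to the complement of `A`, whose demand is
    -- opposite because `D full` is 0, it gives the reverse inequality.
    0≤D : ∀ A → 0# ≤ D A
    0≤D A = x+d≤ (x≤y⇒0≤y-x (D≤ (not ∘ A))) (begin-equality
      D A                                            ≈⟨ solve 2 (λ x y → x := (x :+ y) :- y) refl _ _ ⟩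
      (D A + D (not ∘ A)) - D (not ∘ A)              ≈⟨ +-congʳ (modular A (not ∘ A)) ⟩
      (D (A ∩ not ∘ A) + D (A ∪ not ∘ A)) - D (not ∘ A)
        ≈⟨ +-congʳ (+-cong (trans (cong (∧-inverseʳ ∘ A)) empty) (trans (cong (∨-inverseʳ ∘ A)) all)) ⟩
      (0# + 0#) - D (not ∘ A)                        ≈⟨ +-assoc _ _ _ ⟩
      0# + (0# - D (not ∘ A))                        ∎)
  supply (u ⟶ v [ cap ] ∷ as) (0≤cap ∷ 0≤caps) {D} bal D≤
    with supply as 0≤caps (∂-balanced bal (- FirstArc.amount u v 0≤cap 0≤caps bal D≤) u v)
           (FirstArc.rest≤ u v 0≤cap 0≤caps bal D≤)
  ... | f , 0≤f , f≤ , net≈ = amount Vector.∷ f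
    , (λ { zero → 0≤amount ; (suc e) → 0≤f e })
    , (λ { zero → amount≤cap ; (suc e) → f≤ e })
    , λ A → trans (+-congˡ (net≈ A))
        (solve 3 (λ x y d → x :* y :+ ((:- x) :* y :+ d) := d) refl amount (∂ u v A) (D A))
    where open FirstArc u v 0≤cap 0≤caps bal D≤

-- Maximum flow equals minimum cut.

module MaxFlowMinCut {c ℓ₁ ℓ₂} (K : OrderedField c ℓ₁ ℓ₂) (N : Over.Network K)
  (nodes : List (Over.Network.Node N)) (∈-nodes : ∀ v → v ∈ nodes)
  (0≤capacities : All (λ a → OrderedField._≤_ K (OrderedField.0# K) (Over.Arc.capacity a)) (Over.Network.arcs N))
  (source≢sink : Over.Network.source N ≢ Over.Network.sink N) where

  open OrderedField K hiding (zero)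
  open OrderedFieldProperties K
  open Over K using (IsMaxFlowValue; IsMinCutValue; indicator)
  open Over.Network N
  open Supplies K _≟_ nodes ∈-nodes
  open Sum semiring
  open PosetReasoning poset

  net-singleton : ∀ f v → net arcs f (singleton v) + inflow f v ≈ outflow f v
  net-singleton f v = trans (sym (∑-distrib-+ {length arcs} _ _)) (sum-cong-≋ λ e →
    solve 3 (λ x a b → x :* (a :- b) :+ b :* x := a :* x) refl
      (f e) (indicator (tail e ≟ v)) (indicator (head e ≟ v)))

  net-source : ∀ f → net arcs f (singleton source) ≈ outflow f source - inflow f source
  net-source f = trans
    (solve 2 (λ x y → x := (x :+ y) :- y) refl _ (inflow f source))
    (+-congʳ (net-singleton f source))

  net-conserved : ∀ f v → inflow f v ≈ outflow f v → net arcs f (singleton v) ≈ 0#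
  net-conserved f v in≈out = begin-equality
    net arcs f (singleton v)                            ≈⟨ solve 2 (λ x y → x := (x :+ y) :- y) refl _ (inflow f v) ⟩
    net arcs f (singleton v) + inflow f v - inflow f v  ≈⟨ +-cong (net-singleton f v) (-‿cong in≈out) ⟩
    outflow f v - outflow f v                           ≈⟨ -‿inverseʳ _ ⟩
    0#                                                  ∎

  -- The net flow out of the source side is that of the source alone, because all its other nodes
  -- conserve flow. Arc by arc it is at most the crossing capacity; arcs directed into the source
  -- side contribute at most 0.
  weak-duality : ∀ F C → flowValue F ≤ cutValue C
  weak-duality F C = begin
    outflow amount source - inflow amount source         ≈⟨ net-source amount ⟨
    net arcs amount (singleton source)                   ≈⟨ +-identityʳ _ ⟨
    net arcs amount (singleton source) + 0#              ≈⟨ +-congˡ (vanishing balanced others) ⟨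
    net arcs amount (singleton source) + net arcs amount (A [ source ≔ false ])
                                                         ≈⟨ removal balanced {A} source∈ ⟨
    net arcs amount A                                    ≤⟨ sum-mono-≤ carried ⟩
    cutCapacity arcs A                                   ∎
    where
    open Flow F
    open Cut C renaming (sourceSide to A)
    balanced : Balanced (net arcs amount)
    balanced = net-balanced arcs amount
    others : ∀ v → (A [ source ≔ false ]) v ≡ true → net arcs amount (singleton v) ≈ 0#
    others v v∈ with v ≟ source
    others v () | yes _
    others v v∈ | no v≢source = net-conserved amount v (conservation v v≢source λ { ≡.refl → true≢false (≡.trans (≡.sym v∈) sink∉) })
      where
      true≢false : true ≢ false
      true≢false ()
    carried : ∀ e → amount e * ∂ (tail e) (head e) A ≤ crossing (lookup arcs e) A
    carried e with A (tail e) | A (head e)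
    ... | true  | false = ≤-trans
      (≤-reflexive (solve 1 (λ x → x :* (con (+ 1) :- con +0) := x) refl (amount e))) (feasible e)
    ... | true  | true  = ≤-reflexive (solve 1 (λ x → x :* (con (+ 1) :- con (+ 1)) := con +0) refl (amount e))
    ... | false | false = ≤-reflexive (solve 1 (λ x → x :* (con +0 :- con +0) := con +0) refl (amount e))
    ... | false | true  = x+d≤ (nonNegative e)
      (solve 1 (λ x → con +0 := x :* (con +0 :- con (+ 1)) :+ x) refl (amount e))

  -- Forcing the two terminals to their sides makes the cut value a total function of a subset, so
  -- that `maximiser`, applied to its negative, finds a minimum cut.
  asCut : Subset → Cut
  asCut A = record
    { sourceSide = A [ source ≔ true ] [ sink ≔ false ]
    ; source∈    = source-stays
    ; sink∉      = ≔-updated (A [ source ≔ true ]) sink false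
    }
    where
    source-stays : (A [ source ≔ true ] [ sink ≔ false ]) source ≡ true
    source-stays with source ≟ sink
    ... | yes source≡sink = ⊥-elim (source≢sink source≡sink)
    ... | no  _           = ≔-updated A source true

  asCut-sourceSide : ∀ {A} → A source ≡ true → A sink ≡ false → Cut.sourceSide (asCut A) ≗ A
  asCut-sourceSide {A} source∈ sink∉ v = ≡.trans
    (≔-id (A [ source ≔ true ]) sink (≡.trans (≔-id A source source∈ sink) sink∉) v)
    (≔-id A source source∈ v)

  least : Maximiser (λ A → - cutValue (asCut A))
  least = maximiser _ λ A≗B → -‿cong (cutCapacity-cong arcs (≔-cong sink false (≔-cong source true A≗B)))

  minCut : Cut
  minCut = asCut (proj₁ least)

  value : Carrier
  value = cutValue minCut

  value≤ : ∀ A → A source ≡ true → A sink ≡ false → value ≤ cutCapacity arcs A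
  value≤ A source∈ sink∉ = ≤-trans
    (x+d≤ (x≤y⇒0≤y-x (proj₂ least A))
      (solve 2 (λ x y → y := x :+ ((:- x) :- (:- y))) refl value (cutValue (asCut A))))
    (≤-reflexive (cutCapacity-cong arcs {B = A} (asCut-sourceSide {A} source∈ sink∉)))

  -- The trailing `0#` is the shape that `∂-balanced` produces from `zero-balanced`.
  demand : Subset → Carrier
  demand A = value * ∂ source sink A + 0#

  demand≤ : ∀ A → demand A ≤ cutCapacity arcs A
  demand≤ A with A source in s∈ | A sink in t∈
  ... | true  | true  = ≤-trans
    (≤-reflexive (solve 1 (λ x → x :* (con (+ 1) :- con (+ 1)) :+ con +0 := con +0) refl value))
    (cutCapacity-nonNegative 0≤capacities A)
  ... | false | false = ≤-trans
    (≤-reflexive (solve 1 (λ x → x :* (con +0 :- con +0) :+ con +0 := con +0) refl value))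
    (cutCapacity-nonNegative 0≤capacities A)
  -- The demand is now `- value`, at most 0 because `value` is a cut capacity.
  ... | false | true  = ≤-trans
    (x+d≤ (cutCapacity-nonNegative 0≤capacities (Cut.sourceSide minCut))
      (solve 1 (λ x → con +0 := (x :* (con +0 :- con (+ 1)) :+ con +0) :+ x) refl value))
    (cutCapacity-nonNegative 0≤capacities A)
  ... | true  | false = ≤-trans
    (≤-reflexive (solve 1 (λ x → x :* (con (+ 1) :- con +0) :+ con +0 := x) refl value))
    (value≤ A s∈ t∈)

  maxFlow : ∃[ F ] flowValue F ≈ value
  maxFlow with supply arcs 0≤capacities (∂-balanced zero-balanced value source sink) demand≤
  ... | f , 0≤f , f≤ , net≈ = record
      { amount       = f
      ; nonNegative  = 0≤f
      ; feasible     = f≤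
      ; conservation = λ v v≢source v≢sink → begin-equality
          inflow f v                             ≈⟨ +-identityˡ _ ⟨
          0# + inflow f v                        ≈⟨ +-congʳ (inner v v≢source v≢sink) ⟨
          net arcs f (singleton v) + inflow f v  ≈⟨ net-singleton f v ⟩
          outflow f v                            ∎
      } , trans (sym (net-source f)) at-source
    where
    inner : ∀ v → v ≢ source → v ≢ sink → net arcs f (singleton v) ≈ 0#
    inner v v≢source v≢sink with source ≟ v | sink ≟ v | net≈ (singleton v)
    ... | yes ≡.refl | _          | _    = ⊥-elim (v≢source ≡.refl)
    ... | no  _      | yes ≡.refl | _    = ⊥-elim (v≢sink ≡.refl)
    ... | no  _      | no  _      | net≈ = trans net≈
      (solve 1 (λ x → x :* (con +0 :- con +0) :+ con +0 := con +0) refl value)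
    at-source : net arcs f (singleton source) ≈ value
    at-source with source ≟ source | sink ≟ source | net≈ (singleton source)
    ... | no  source≢source | _                | _    = ⊥-elim (source≢source ≡.refl)
    ... | yes _             | yes sink≡source  | _    = ⊥-elim (source≢sink (≡.sym sink≡source))
    ... | yes _             | no  _            | net≈ = trans net≈
      (solve 1 (λ x → x :* (con (+ 1) :- con +0) :+ con +0 := x) refl value)

  max-flow-min-cut : ∃[ v ] IsMaxFlowValue N v × IsMinCutValue N v
  max-flow-min-cut = value
    , (maxFlow , λ F → weak-duality F minCut)
    , ((minCut , refl) , λ C → value≤ (Cut.sourceSide C) (Cut.source∈ C) (Cut.sink∉ C))

-- Concatenated lists and Boolean threshold sequences.

∈-concatMap-allFin : ∀ {a} {A : Set a} {n} (f : Fin n → List A) i {x} → x ∈ f i → x ∈ concatMap f (allFin n)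
∈-concatMap-allFin f i x∈ = ∈.∈-concatMap⁺ f (lose (∈.∈-allFin i) x∈)

All-concatMap : ∀ {a b p} {A : Set a} {B : Set b} {P : B → Set p} (f : A → List B) →
  (∀ x → All P (f x)) → ∀ xs → All P (concatMap f xs)
All-concatMap f Pf []       = []
All-concatMap f Pf (x ∷ xs) = All.++⁺ (Pf x) (All-concatMap f Pf xs)

-- The indicator of j + 1 > a, the extra 1 turning an index of Fin into one
-- counted from 1.
τ : ℕ → ℕ → Bool
τ a j = does (a ℕ.<? suc j)

-- Stated as the condition for an arc to cross, so that it directly closes the implication arcs
-- along a row or a column.
τ-mono : ∀ a {j k} → j ℕ.≤ k → τ a j ∧ not (τ a k) ≡ false
τ-mono a {j} {k} j≤k with a ℕ.≤? j
... | yes a≤j rewrite dec-true (a ℕ.<? suc k) (ℕ.s≤s (ℕ.≤-trans a≤j j≤k)) = ∧-zeroʳ _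
... | no  a≰j rewrite dec-false (a ℕ.<? suc j) (a≰j ∘ ℕ.s≤s⁻¹) = ≡.refl

-- Only consecutive indices are compared, as a single implication arc does. Comparing through `toℕ`
-- lets the property pass to `p ∘ suc`.
Increasing : ∀ {n} → (Fin n → Bool) → Set
Increasing p = ∀ {j k} → toℕ k ≡ suc (toℕ j) → p j ≡ true → p k ≡ true

increasing⇒all-true : ∀ {n} {p : Fin (suc n) → Bool} → Increasing p → p zero ≡ true → ∀ j → p j ≡ true
increasing⇒all-true         incr p₀ zero    = p₀
increasing⇒all-true {suc n} incr p₀ (suc j) =
  increasing⇒all-true (λ k≡ → incr (≡.cong suc k≡)) (incr ≡.refl p₀) j

-- The threshold is the number of leading `false` values; it is `n` when there is no `true`.
increasing⇒threshold : ∀ {n} {p : Fin n → Bool} → Increasing p →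
  ∃[ a ] ∀ j → p j ≡ τ (toℕ {suc n} a) (toℕ j)
increasing⇒threshold {zero}      incr = zero , λ ()
increasing⇒threshold {suc n} {p} incr with p zero in p₀
... | true  = zero , increasing⇒all-true incr p₀
... | false with increasing⇒threshold {n} {p ∘ suc} (λ k≡ → incr (≡.cong suc k≡))
...   | a , p≡ = suc a , λ { zero → p₀ ; (suc j) → p≡ j }

-- Telescoping sums, and sums over lists of arcs.

module Telescoping {c ℓ₁ ℓ₂} (K : OrderedField c ℓ₁ ℓ₂) where

  open OrderedField K hiding (zero)
  open OrderedFieldProperties K
  open Mult semiring renaming (_×_ to _·_)
  open Sum semiring
  open SetoidReasoning setoid

  -- The weights keep exactly the indices from `a` on, so a tail of the telescoping sum remains.
  telescope : ∀ {n} (G : Fin (suc n) → Carrier) a →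
    ∑[ j < n ] (χ (τ (toℕ a) (toℕ j)) * (G (inject₁ j) - G (suc j))) ≈ G a - G (fromℕ n)
  telescope {zero}  G zero    = sym (-‿inverseʳ (G zero))
  telescope {suc n} G zero    = trans (+-congˡ (telescope (G ∘ suc) zero))
    (solve 3 (λ x y z → con (+ 1) :* (x :- y) :+ (y :- z) := x :- z) refl _ _ _)
  telescope {suc n} G (suc a) = trans (+-congˡ (telescope (G ∘ suc) a))
    (solve 2 (λ x y → con +0 :* x :+ y := y) refl _ _)

  count : ∀ {n} (a : Fin (suc n)) x → ∑[ j < n ] (χ (τ (toℕ a) (toℕ j)) * x) ≈ (n ∸ toℕ a) · x
  count {zero}  zero    x = refl
  count {suc n} zero    x = +-cong (*-identityˡ x) (count {n} zero x)
  count {suc n} (suc a) x = trans (+-congˡ (count a x))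
    (solve 2 (λ x y → con +0 :* x :+ y := y) refl _ _)

module ListSums {c ℓ₁ ℓ₂} (K : OrderedField c ℓ₁ ℓ₂) {a} {A : Set a}
  (F : A → OrderedField.Carrier K) where

  open OrderedField K hiding (zero)
  open Sum semiring

  total : List A → Carrier
  total xs = sum λ e → F (lookup xs e)

  total-++ : ∀ xs ys → total (xs ++ ys) ≈ total xs + total ys
  total-++ []       ys = sym (+-identityˡ _)
  total-++ (x ∷ xs) ys = trans (+-congˡ (total-++ xs ys)) (sym (+-assoc _ _ _))

  total-map-allFin : ∀ {n} (f : Fin n → A) → total (map f (allFin n)) ≈ ∑[ i < n ] F (f i)
  total-map-allFin f = go f id
    where
    -- `allFin` is `tabulate id`; the induction needs an arbitrary function in place of `id`.
    go : ∀ {k n} (f : Fin n → A) (g : Fin k → Fin n) →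
         total (map f (List.tabulate g)) ≈ ∑[ i < k ] F (f (g i))
    go {zero}  f g = refl
    go {suc k} f g = +-congˡ (go f (g ∘ suc))

  total-concatMap-allFin : ∀ {n} (f : Fin n → List A) →
    total (concatMap f (allFin n)) ≈ ∑[ i < n ] total (f i)
  total-concatMap-allFin f = go f id
    where
    go : ∀ {k n} (f : Fin n → List A) (g : Fin k → Fin n) →
         total (concatMap f (List.tabulate g)) ≈ ∑[ i < k ] total (f (g i))
    go {zero}  f g = refl
    go {suc k} f g = trans (total-++ (f (g zero)) _) (+-congˡ (go f (g ∘ suc)))

-- Coefficients, nodes and capacities of the network.

module Game {c ℓ₁ ℓ₂} (K : OrderedField c ℓ₁ ℓ₂) {m : ℕ} (1≤m : 1 ℕ.≤ m)
  (profile : Over.StepProfile K m) where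

  open OrderedField K hiding (zero)
  open OrderedFieldProperties K
  open Over K
  open Profile profile
  open StepProfile profile renaming (height to h)
  open Mult semiring renaming (_×_ to _·_)
  open Sum semiring
  open Telescoping K
  open ListSums K
  open PosetReasoning poset

  m²-positive : 0# < (m ℕ.* m) · 1#
  m²-positive = ·1-positive (ℕ.*-mono-≤ 1≤m 1≤m)

  κ : Carrier
  κ = ((m ℕ.* m) · 1#) ⁻¹

  0≤κ : 0# ≤ κ
  0≤κ = ⁻¹-nonNegative m²-positive

  h+h-positive : ∀ i j → 0# < h i + h j
  h+h-positive i j = +-positive (positive i) (proj₁ (positive j))

  -- With x, y, z the heights at i, j, k, the difference y / (x + y) - z / (x + z) equals x (y - z)
  -- / ((x + y) (x + z)).
  ratio-mono : ∀ i {j k} → h k ≤ h j → h k / (h i + h k) ≤ h j / (h i + h j)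
  ratio-mono i {j} {k} hk≤hj = x+d≤
    (*-nonNegative (*-nonNegative (proj₁ (positive i)) (x≤y⇒0≤y-x hk≤hj))
                   (*-nonNegative (0≤⁻¹ j) (0≤⁻¹ k)))
    (begin-equality
      y * B                                        ≈⟨ *-congˡ (*-identityʳ B) ⟨
      y * (B * 1#)                                 ≈⟨ *-congˡ (*-congˡ (inverse k)) ⟨
      y * (B * ((x + z) * C))
        ≈⟨ solve 5 (λ x y z B C → y :* (B :* ((x :+ z) :* C)) :=
             z :* (C :* ((x :+ y) :* B)) :+ (x :* (y :- z)) :* (B :* C)) refl x y z B C ⟩
      z * (C * ((x + y) * B)) + (x * (y - z)) * (B * C)
                                                   ≈⟨ +-congʳ (*-congˡ (*-congˡ (inverse j))) ⟩
      z * (C * 1#) + (x * (y - z)) * (B * C)       ≈⟨ +-congʳ (*-congˡ (*-identityʳ C)) ⟩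
      z * C + (x * (y - z)) * (B * C)              ∎)
    where
    x y z B C : Carrier
    x = h i
    y = h j
    z = h k
    B = (h i + h j) ⁻¹
    C = (h i + h k) ⁻¹
    0≤⁻¹ : ∀ l → 0# ≤ (h i + h l) ⁻¹
    0≤⁻¹ l = ⁻¹-nonNegative (h+h-positive i l)
    inverse : ∀ l → (h i + h l) * (h i + h l) ⁻¹ ≈ 1#
    inverse l = ⁻¹-inverseʳ _ (0<⇒≉0 (h+h-positive i l))

  g-fromℕ : ∀ i → g i (fromℕ m) ≡ 0#
  g-fromℕ i rewrite view-fromℕ m = ≡.refl

  g-nonNegative : ∀ i k → 0# ≤ g i k
  g-nonNegative i k with view k
  ... | ‵fromℕ     = ≤-refl
  ... | ‵inject₁ j = *-nonNegative (proj₁ (positive j)) (⁻¹-nonNegative (h+h-positive i j))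

  g-antitone : ∀ i j k → toℕ j ℕ.≤ toℕ k → g i k ≤ g i (inject₁ j)
  g-antitone i j k j≤k with view k
  ... | ‵fromℕ      = g-nonNegative i (inject₁ j)
  ... | ‵inject₁ k′ rewrite view-inject₁ j =
    ratio-mono i (antitone (ℕ.≤-trans j≤k (ℕ.≤-reflexive (Fin.toℕ-inject₁ k′))))

  q-nonNegative : ∀ i j → 0# ≤ q i j
  q-nonNegative i j = x≤y⇒0≤y-x (g-antitone i j (suc j) (ℕ.n≤1+n (toℕ j)))

  -- With j counted from 1, r is g at j plus m - j times the drop of g from column j to column j +
  -- 1.
  r-nonNegative : ∀ i j → 0# ≤ r i j
  r-nonNegative i j = ≤-trans
    (+-nonNegative (g-nonNegative i (inject₁ j))
      (x≤y⇒0≤y-x (·-monoʳ-≤ (m ∸ suc (toℕ j)) (g-antitone i j (suc j) (ℕ.n≤1+n (toℕ j))))))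
    (≤-reflexive (begin-equality
      g₀ + (N · g₀ - N · g₁)           ≈⟨ +-assoc _ _ _ ⟨
      suc N · g₀ - N · g₁              ≡⟨ ≡.cong (λ k → k · g₀ - N · g₁) (ℕ.+-∸-assoc 1 (Fin.toℕ<n j)) ⟨
      (m ∸ toℕ j) · g₀ - N · g₁        ∎))
    where
    N : ℕ
    N = m ∸ suc (toℕ j)
    g₀ g₁ : Carrier
    g₀ = g i (inject₁ j)
    g₁ = g i (suc j)

  -- The tail of the telescoping sum ends at column m + 1, where g is 0. For `a i` in place of `a`
  -- the result is `P a i`.
  threshold-q : ∀ i a → ∑[ j < m ] (χ (τ (toℕ a) (toℕ j)) * q i j) ≈ g i a
  threshold-q i a = begin-equality
    ∑[ j < m ] (χ (τ (toℕ a) (toℕ j)) * q i j)  ≈⟨ telescope (g i) a ⟩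
    g i a - g i (fromℕ m)                       ≡⟨ ≡.cong (λ x → g i a - x) (g-fromℕ i) ⟩
    g i a - 0#                                  ≈⟨ solve 1 (λ x → x :- con +0 := x) refl _ ⟩
    g i a                                       ∎

  -- r is the difference of consecutive values of `G`, so its tail sum is m - a copies of g at `a`.
  -- Writing these copies as a sum over the same indices matches the products U P and Ṽ Q of the
  -- payoff.
  threshold-r : ∀ i a → ∑[ j < m ] (χ (τ (toℕ a) (toℕ j)) * r i j) ≈
                        ∑[ j < m ] (χ (τ (toℕ a) (toℕ j)) * g i a)
  threshold-r i a = begin-equality
    ∑[ j < m ] (χ (τ (toℕ a) (toℕ j)) * r i j)
      ≡⟨ sum-cong-≗ {m} (λ j → ≡.cong (λ k → χ (τ (toℕ a) (toℕ j)) * ((m ∸ k) · g i (inject₁ j) - G (suc j)))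
           (≡.sym (Fin.toℕ-inject₁ j))) ⟩
    ∑[ j < m ] (χ (τ (toℕ a) (toℕ j)) * (G (inject₁ j) - G (suc j)))  ≈⟨ telescope G a ⟩
    G a - G (fromℕ m)
      -- The end term vanishes through its factor m - m.
      ≡⟨ ≡.cong (λ k → G a - k · g i (fromℕ m)) (≡.trans (≡.cong (m ∸_) (Fin.toℕ-fromℕ m)) (ℕ.n∸n≡0 m)) ⟩
    G a - 0#                                                          ≈⟨ solve 1 (λ x → x :- con +0 := x) refl _ ⟩
    (m ∸ toℕ a) · g i a                                               ≈⟨ count a (g i a) ⟨
    ∑[ j < m ] (χ (τ (toℕ a) (toℕ j)) * g i a)                        ∎
    where
    G : Fin (suc m) → Carrier
    G k = (m ∸ toℕ k) · g i k

  -- The arcs between `Y` nodes make their source side closed under decreasing the row, so it is the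
  -- complement that has a threshold: `X` carries U, and `Y` the negation of Ṽ.
  side : Thresholds → Thresholds → Node m → Bool
  side a b s       = true
  side a b t       = false
  side a b (X i j) = τ (toℕ (a i)) (toℕ j)
  side a b (Y i j) = not (τ (toℕ (b j)) (toℕ i))

  cell : Fin m → Fin m → List (Node m)
  cell i j = X i j ∷ Y i j ∷ []

  nodes : List (Node m)
  nodes = s ∷ t ∷ concatMap (λ i → concatMap (cell i) (allFin m)) (allFin m)

  cell⊆nodes : ∀ i j {v} → v ∈ cell i j → v ∈ nodes
  cell⊆nodes i j v∈ = there (there (∈-concatMap-allFin (λ i → concatMap (cell i) (allFin m)) i
    (∈-concatMap-allFin (cell i) j v∈)))

  ∈-nodes : ∀ v → v ∈ nodes
  ∈-nodes s       = here ≡.refl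
  ∈-nodes t       = there (here ≡.refl)
  ∈-nodes (X i j) = cell⊆nodes i j (here ≡.refl)
  ∈-nodes (Y i j) = cell⊆nodes i j (there (here ≡.refl))

  open Supplies K _≟ₙ_ nodes ∈-nodes
    using (NonNegative; crossing; crossing-nonNegative; cutCapacity; cutCapacity-cong)

  0≤2 : 0# ≤ 2#
  0≤2 = +-nonNegative 0≤1 0≤1

  0≤/m² : ∀ {x} → 0# ≤ x → 0# ≤ x /m²
  0≤/m² 0≤x = *-nonNegative 0≤x 0≤κ

  arcAt-nonNegative : ∀ k arc → (∀ j → 0# ≤ Arc.capacity (arc j)) → NonNegative (arcAt k arc)
  arcAt-nonNegative k arc 0≤arc with view k
  ... | ‵fromℕ     = []
  ... | ‵inject₁ j = 0≤arc j ∷ []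

  map-nonNegative : ∀ (arc : Fin m → Arc (Node m)) → (∀ j → 0# ≤ Arc.capacity (arc j)) →
                    NonNegative (map arc (allFin m))
  map-nonNegative arc 0≤arc = All.map⁺ (All.tabulate λ {j} _ → 0≤arc j)

  𝒩-nonNegative : NonNegative (Network.arcs 𝒩)
  𝒩-nonNegative = All-concatMap _ (λ i → All-concatMap _ (arcsAt-nonNegative i) (allFin m)) (allFin m)
    where
    arcsAt-nonNegative : ∀ i j → NonNegative (arcsAt i j)
    arcsAt-nonNegative i j =
        0≤/m² (r-nonNegative j i) ∷ 0≤/m² 0≤1 ∷ 0≤/m² (r-nonNegative i j) ∷ 0≤2
      ∷ All.++⁺ (map-nonNegative (λ k → X i j ⟶ Y i k [ q i j /m² ]) λ _ → 0≤/m² (q-nonNegative i j))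
        (All.++⁺ (map-nonNegative (λ k → X i j ⟶ Y k j [ q j k /m² ]) λ k → 0≤/m² (q-nonNegative j k))
        (All.++⁺ (arcAt-nonNegative (suc j) (λ j⁺ → X i j ⟶ X i j⁺ [ 2# ]) λ _ → 0≤2)
                 (arcAt-nonNegative (suc i) (λ i⁺ → Y i⁺ j ⟶ Y i j [ 2# ]) λ _ → 0≤2)))

  -- The value of a threshold cut.

  ∑∑ : (Fin m → Fin m → Carrier) → Carrier
  ∑∑ f = ∑[ i < m ] ∑[ j < m ] f i j

  ∑∑-cong : ∀ {f f′} → (∀ i j → f i j ≈ f′ i j) → ∑∑ f ≈ ∑∑ f′
  ∑∑-cong f≈f′ = sum-cong-≋ {m} λ i → sum-cong-≋ {m} (f≈f′ i)

  ∑∑-distrib-+ : ∀ f f′ → ∑∑ (λ i j → f i j + f′ i j) ≈ ∑∑ f + ∑∑ f′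
  ∑∑-distrib-+ f f′ = trans (sum-cong-≋ {m} λ i → ∑-distrib-+ {m} (f i) (f′ i)) (∑-distrib-+ {m} _ _)

  ∑∑-*κ : ∀ f → ∑∑ (λ i j → f i j * κ) ≈ ∑∑ f * κ
  ∑∑-*κ f = trans (sum-cong-≋ {m} λ i → sym (*-distribʳ-sum {m} κ (f i))) (sym (*-distribʳ-sum {m} κ _))

  χ-not : ∀ b → χ (not b) ≈ 1# - χ b
  χ-not false = solve 0 (con (+ 1) := con (+ 1) :- con +0) refl
  χ-not true  = solve 0 (con +0 := con (+ 1) :- con (+ 1)) refl

  χ-∧ : ∀ p q → χ p * χ q ≈ χ (p ∧ q)
  χ-∧ false q = zeroˡ _
  χ-∧ true  q = *-identityˡ _

  -- Turns a crossing capacity into a polynomial that the solver can handle.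
  if-χ : ∀ p q x → (if p ∧ not q then x else 0#) ≈ χ p * (1# - χ q) * x
  if-χ p q x = trans (if-* (p ∧ not q)) (*-congʳ (trans (sym (χ-∧ p (not q))) (*-congˡ (χ-not q))))
    where
    if-* : ∀ b → (if b then x else 0#) ≈ χ b * x
    if-* false = sym (zeroˡ x)
    if-* true  = sym (*-identityˡ x)

  module _ (a b : Thresholds) where

    private
      u v : Fin m → Fin m → Bool
      u i j = τ (toℕ (a i)) (toℕ j)
      v i j = τ (toℕ (b j)) (toℕ i)

    Uq Ṽq : Fin m → Fin m → Carrier
    Uq i j = ∑[ k < m ] (U a i j * Ṽ b i k * q i j)
    Ṽq i j = ∑[ k < m ] (U a i j * Ṽ b k j * q j k)

    -- The crossing capacity of the arcs in `arcsAt i j`, scaled by m² and listed in their order;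
    -- the implication arcs contribute nothing. `Uq` and `Ṽq` are the two families from `X i j` to
    -- `Y i k` and to `Y k j`.
    local : Fin m → Fin m → Carrier
    local i j = Ṽ b i j * r j i + (S a b i j + (U a i j * r i j + (Uq i j + Ṽq i j)))

    payoff : Fin m → Fin m → Carrier
    payoff i j = S a b i j + (U a i j + Ṽ b i j) * (P a i + Q b j)

    ∑∑-Ṽr : ∑∑ (λ i j → Ṽ b i j * r j i) ≈ ∑∑ (λ i j → Ṽ b i j * Q b j)
    ∑∑-Ṽr = begin-equality
      ∑∑ (λ i j → Ṽ b i j * r j i)    ≈⟨ ∑-comm {m} {m} _ ⟩
      ∑∑ (λ j i → Ṽ b i j * r j i)    ≈⟨ sum-cong-≋ {m} (λ j → threshold-r j (b j)) ⟩
      ∑∑ (λ j i → Ṽ b i j * Q b j)    ≈⟨ ∑-comm {m} {m} _ ⟩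
      ∑∑ (λ i j → Ṽ b i j * Q b j)    ∎

    ∑∑-Ur : ∑∑ (λ i j → U a i j * r i j) ≈ ∑∑ (λ i j → U a i j * P a i)
    ∑∑-Ur = sum-cong-≋ {m} λ i → threshold-r i (a i)

    -- Summing over the column of the `X` node first collapses q to `P a i`; the column `k` of the
    -- `Y` node then becomes the column index of the result.
    ∑∑-Uq : ∑∑ Uq ≈ ∑∑ (λ i j → Ṽ b i j * P a i)
    ∑∑-Uq = sum-cong-≋ {m} λ i → begin-equality
      ∑[ j < m ] ∑[ k < m ] (U a i j * Ṽ b i k * q i j)    ≈⟨ ∑-comm {m} {m} _ ⟩
      ∑[ k < m ] ∑[ j < m ] (U a i j * Ṽ b i k * q i j)
        ≈⟨ sum-cong-≋ {m} (λ k → sum-cong-≋ {m} λ j →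
             solve 3 (λ x y z → x :* y :* z := y :* (x :* z)) refl (U a i j) (Ṽ b i k) (q i j)) ⟩
      ∑[ k < m ] ∑[ j < m ] (Ṽ b i k * (U a i j * q i j))
        ≈⟨ sum-cong-≋ {m} (λ k → sym (*-distribˡ-sum {m} (Ṽ b i k) _)) ⟩
      ∑[ k < m ] (Ṽ b i k * ∑[ j < m ] (U a i j * q i j))
        ≈⟨ sum-cong-≋ {m} (λ k → *-congˡ (threshold-q i (a i))) ⟩
      ∑[ k < m ] (Ṽ b i k * P a i)                         ∎

    ∑∑-Ṽq : ∑∑ Ṽq ≈ ∑∑ (λ i j → U a i j * Q b j)
    ∑∑-Ṽq = ∑∑-cong λ i j → begin-equality
      ∑[ k < m ] (U a i j * Ṽ b k j * q j k)    ≈⟨ sum-cong-≋ {m} (λ k → *-assoc _ _ _) ⟩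
      ∑[ k < m ] (U a i j * (Ṽ b k j * q j k))  ≈⟨ *-distribˡ-sum {m} (U a i j) _ ⟨
      U a i j * ∑[ k < m ] (Ṽ b k j * q j k)    ≈⟨ *-congˡ (threshold-q j (b j)) ⟩
      U a i j * Q b j                           ∎

    -- The four telescoped sums are the four products in the expansion of (U + Ṽ) (P + Q); the S
    -- terms agree already.
    ∑∑-local : ∑∑ local ≈ ∑∑ payoff
    ∑∑-local = begin-equality
      ∑∑ local
        ≈⟨ split _ _ _ _ _ ⟩
      ∑∑ (λ i j → Ṽ b i j * r j i) + (∑∑ (S a b) + (∑∑ (λ i j → U a i j * r i j) + (∑∑ Uq + ∑∑ Ṽq)))
        ≈⟨ +-cong ∑∑-Ṽr (+-congˡ (+-cong ∑∑-Ur (+-cong ∑∑-Uq ∑∑-Ṽq))) ⟩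
      ∑∑ (λ i j → Ṽ b i j * Q b j) + (∑∑ (S a b) + (∑∑ (λ i j → U a i j * P a i)
        + (∑∑ (λ i j → Ṽ b i j * P a i) + ∑∑ (λ i j → U a i j * Q b j))))
        ≈⟨ split _ _ _ _ _ ⟨
      ∑∑ (λ i j → Ṽ b i j * Q b j + (S a b i j + (U a i j * P a i + (Ṽ b i j * P a i + U a i j * Q b j))))
        ≈⟨ ∑∑-cong (λ i j → solve 5 (λ U V S P Q → V :* Q :+ (S :+ (U :* P :+ (V :* P :+ U :* Q))) :=
             S :+ (U :+ V) :* (P :+ Q)) refl (U a i j) (Ṽ b i j) (S a b i j) (P a i) (Q b j)) ⟩
      ∑∑ payoff ∎
      where
      split : ∀ f₁ f₂ f₃ f₄ f₅ → ∑∑ (λ i j → f₁ i j + (f₂ i j + (f₃ i j + (f₄ i j + f₅ i j)))) ≈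
                                 ∑∑ f₁ + (∑∑ f₂ + (∑∑ f₃ + (∑∑ f₄ + ∑∑ f₅)))
      split f₁ f₂ f₃ f₄ f₅ = trans (∑∑-distrib-+ f₁ _) (+-congˡ (trans (∑∑-distrib-+ f₂ _)
        (+-congˡ (trans (∑∑-distrib-+ f₃ _) (+-congˡ (∑∑-distrib-+ f₄ f₅))))))

    module _ (disjoint : ∀ i j → u i j ∧ v i j ≡ false) where

      private
        A : Node m → Bool
        A = side a b

        F : Arc (Node m) → Carrier
        F arc = crossing arc A

      arcAt-closed : ∀ k (arc : Fin m → Arc (Node m)) → (∀ l → k ≡ inject₁ l → F (arc l) ≈ 0#) →
                     total F (arcAt k arc) ≈ 0#
      arcAt-closed k arc closed with view k
      ... | ‵fromℕ     = refl
      ... | ‵inject₁ l = trans (+-identityʳ _) (closed l ≡.refl)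

      next : ∀ {i : Fin m} {l : Fin m} → suc i ≡ inject₁ l → toℕ l ≡ suc (toℕ i)
      next {l = l} eq = ≡.trans (≡.sym (Fin.toℕ-inject₁ l)) (≡.cong toℕ (≡.sym eq))

      arcsAt-crossing : ∀ i j → total F (arcsAt i j) ≈ local i j * κ
      arcsAt-crossing i j = begin-equality
        F (s ⟶ Y i j [ r j i /m² ]) + (F (Y i j ⟶ X i j [ 1# /m² ]) + (F (X i j ⟶ t [ r i j /m² ])
          + (F (X i j ⟶ Y i j [ 2# ]) + total F (L₁ ++ L₂ ++ L₃ ++ L₄))))
          ≈⟨ +-cong (if-χ true (not (v i j)) _) (+-cong (if-χ (not (v i j)) (u i j) _)
               (+-cong (if-χ (u i j) false _) (+-cong X→Y lists))) ⟩
        1# * (1# - χ (not (v i j))) * (r j i * κ) + (χ (not (v i j)) * (1# - χ (u i j)) * (1# * κ)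
          + (χ (u i j) * (1# - 0#) * (r i j * κ) + (0# + (Uq i j * κ + (Ṽq i j * κ + (0# + 0#))))))
          ≈⟨ +-cong (*-congʳ (*-congˡ (+-congˡ (-‿cong (χ-not (v i j))))))
                    (+-congʳ (*-congʳ (*-congʳ (χ-not (v i j))))) ⟩
        1# * (1# - (1# - Ṽ b i j)) * (r j i * κ) + ((1# - Ṽ b i j) * (1# - U a i j) * (1# * κ)
          + (U a i j * (1# - 0#) * (r i j * κ) + (0# + (Uq i j * κ + (Ṽq i j * κ + (0# + 0#))))))
          ≈⟨ solve 7 (λ U V r r′ x y κ →
               con (+ 1) :* (con (+ 1) :- (con (+ 1) :- V)) :* (r′ :* κ)
                 :+ ((con (+ 1) :- V) :* (con (+ 1) :- U) :* (con (+ 1) :* κ)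
                 :+ (U :* (con (+ 1) :- con +0) :* (r :* κ)
                 :+ (con +0 :+ (x :* κ :+ (y :* κ :+ (con +0 :+ con +0))))))
               := (V :* r′ :+ ((con (+ 1) :- U) :* (con (+ 1) :- V) :+ (U :* r :+ (x :+ y)))) :* κ)
               refl (U a i j) (Ṽ b i j) (r i j) (r j i) (Uq i j) (Ṽq i j) κ ⟩
        local i j * κ ∎
        where
        L₁ L₂ L₃ L₄ : List (Arc (Node m))
        L₁ = map (λ k → X i j ⟶ Y i k [ q i j /m² ]) (allFin m)
        L₂ = map (λ k → X i j ⟶ Y k j [ q j k /m² ]) (allFin m)
        L₃ = arcAt (suc j) (λ j⁺ → X i j ⟶ X i j⁺ [ 2# ])
        L₄ = arcAt (suc i) (λ i⁺ → Y i⁺ j ⟶ Y i j [ 2# ])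

        uncrossed : ∀ {p x} → p ≡ false → (if p then x else 0#) ≈ 0#
        uncrossed ≡.refl = refl

        -- Disjointness of U and Ṽ is used here: it keeps this arc uncrossed.
        X→Y : F (X i j ⟶ Y i j [ 2# ]) ≈ 0#
        X→Y = uncrossed (≡.trans (≡.cong (u i j ∧_) (not-involutive (v i j))) (disjoint i j))

        q-term : ∀ p q x → (if p ∧ not (not q) then x * κ else 0#) ≈ χ p * χ q * x * κ
        q-term p q x = trans (if-χ p (not q) (x * κ))
          (trans (*-congʳ (*-congˡ (+-congˡ (-‿cong (χ-not q)))))
          (solve 4 (λ p q x κ → p :* (con (+ 1) :- (con (+ 1) :- q)) :* (x :* κ) := p :* q :* x :* κ) refl
            (χ p) (χ q) x κ))

        L₁≈ : total F L₁ ≈ Uq i j * κ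
        L₁≈ = trans (total-map-allFin F {m} (λ k → X i j ⟶ Y i k [ q i j /m² ]))
          (trans (sum-cong-≋ {m} λ k → q-term (u i j) (v i k) (q i j)) (sym (*-distribʳ-sum {m} κ _)))

        L₂≈ : total F L₂ ≈ Ṽq i j * κ
        L₂≈ = trans (total-map-allFin F {m} (λ k → X i j ⟶ Y k j [ q j k /m² ]))
          (trans (sum-cong-≋ {m} λ k → q-term (u i j) (v k j) (q j k)) (sym (*-distribʳ-sum {m} κ _)))

        L₃≈ : total F L₃ ≈ 0#
        L₃≈ = arcAt-closed (suc j) _ λ l sj≡l → uncrossed
          (τ-mono (toℕ (a i)) (ℕ.≤-trans (ℕ.n≤1+n _) (ℕ.≤-reflexive (≡.sym (next sj≡l)))))

        L₄≈ : total F L₄ ≈ 0#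
        L₄≈ = arcAt-closed (suc i) _ λ l si≡l → uncrossed
          (≡.trans (∧-comm (not (v l j)) _) (≡.trans (≡.cong (_∧ not (v l j)) (not-involutive (v i j)))
            (τ-mono (toℕ (b j)) (ℕ.≤-trans (ℕ.n≤1+n _) (ℕ.≤-reflexive (≡.sym (next si≡l)))))))

        lists : total F (L₁ ++ L₂ ++ L₃ ++ L₄) ≈ Uq i j * κ + (Ṽq i j * κ + (0# + 0#))
        lists = trans (total-++ F L₁ _) (+-cong L₁≈ (trans (total-++ F L₂ _) (+-cong L₂≈
          (trans (total-++ F L₃ _) (+-cong L₃≈ L₄≈)))))

      side-cutCapacity : cutCapacity (Network.arcs 𝒩) A ≈ ∑∑ payoff * κ
      side-cutCapacity = begin-equality
        total F (Network.arcs 𝒩)           ≈⟨ total-concatMap-allFin F {m} _ ⟩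
        ∑[ i < m ] total F (concatMap (arcsAt i) (allFin m))
                                           ≈⟨ sum-cong-≋ {m} (λ i → total-concatMap-allFin F {m} (arcsAt i)) ⟩
        ∑∑ (λ i j → total F (arcsAt i j))  ≈⟨ ∑∑-cong arcsAt-crossing ⟩
        ∑∑ (λ i j → local i j * κ)         ≈⟨ ∑∑-*κ local ⟩
        ∑∑ local * κ                       ≈⟨ *-congʳ ∑∑-local ⟩
        ∑∑ payoff * κ                      ∎

  -- Minimum cuts are threshold cuts.

  arcsAt∈ : ∀ i j {arc} → arc ∈ arcsAt i j → arc ∈ Network.arcs 𝒩
  arcsAt∈ i j arc∈ = ∈-concatMap-allFin (λ i → concatMap (arcsAt i) (allFin m)) i
    (∈-concatMap-allFin (arcsAt i) j arc∈)

  -- `arcAt` is defined through `view`, whose value at `inject₁ k` is known; membership is proved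
  -- there and transported to `suc j`, the same element.
  arcAt∈ : ∀ {j k : Fin m} (arc : Fin m → Arc (Node m)) → toℕ k ≡ suc (toℕ j) → arc k ∈ arcAt (suc j) arc
  arcAt∈ {j} {k} arc k≡ = ≡.subst (λ l → arc k ∈ arcAt l arc) inject₁≡suc at-inject₁
    where
    inject₁≡suc : inject₁ k ≡ suc j
    inject₁≡suc = Fin.toℕ-injective (≡.trans (Fin.toℕ-inject₁ k) k≡)
    at-inject₁ : arc k ∈ arcAt (inject₁ k) arc
    at-inject₁ rewrite view-inject₁ k = here ≡.refl

  module MinimumCut (C : Network.Cut 𝒩) {value : Carrier} (cut≈value : Network.cutValue 𝒩 C ≈ value)
    (value≤cut : ∀ C′ → value ≤ Network.cutValue 𝒩 C′) where

    open Network.Cut C renaming (sourceSide to A)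

    value≤side : ∀ a b (disjoint : ∀ i j → τ (toℕ (a i)) (toℕ j) ∧ τ (toℕ (b j)) (toℕ i) ≡ false) →
                 value ≤ ∑∑ (payoff a b) * κ
    value≤side a b disjoint = ≤-trans
      (value≤cut (record { sourceSide = side a b ; source∈ = ≡.refl ; sink∉ = ≡.refl }))
      (≤-reflexive (side-cutCapacity a b disjoint))

    value≤Γ : ∀ x → value ≤ Γ x
    value≤Γ ((a , b) , UṼ≈0) = value≤side a b λ i j →
      disjoint (τ (toℕ (a i)) (toℕ j)) (τ (toℕ (b j)) (toℕ i)) (UṼ≈0 i j)
      where
      disjoint : ∀ p q → χ p * χ q ≈ 0# → p ∧ q ≡ false
      disjoint false q     _  = ≡.refl
      disjoint true  false _  = ≡.refl
      disjoint true  true  ≈0 = ⊥-elim (0≉1 (trans (sym ≈0) (*-identityˡ 1#)))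

    -- With all thresholds equal to m, both U and Ṽ vanish, so each of the m² cells pays S = 1.
    value≤1 : value ≤ 1#
    value≤1 = ≤-trans (value≤side top top λ i j → ≡.cong (_∧ τ (toℕ (top j)) (toℕ i)) (top-false j))
      (≤-reflexive (begin-equality
        ∑∑ (payoff top top) * κ            ≈⟨ *-congʳ (∑∑-cong one) ⟩
        ∑∑ (λ _ _ → 1#) * κ                ≈⟨ *-congʳ (trans (sum-cong-≋ {m} λ _ → sum-replicate m) (sum-replicate m)) ⟩
        (m · (m · 1#)) * κ                 ≈⟨ *-congʳ (×-assocˡ 1# m m) ⟩
        ((m ℕ.* m) · 1#) * κ               ≈⟨ ⁻¹-inverseʳ _ (0<⇒≉0 m²-positive) ⟩
        1#                                 ∎))
      where
      top : Thresholds
      top _ = fromℕ m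
      top-false : (j : Fin m) → τ (toℕ (fromℕ m)) (toℕ j) ≡ false
      top-false j = dec-false (toℕ (fromℕ m) ℕ.<? suc (toℕ j)) λ m<j →
        ℕ.<⇒≱ (Fin.toℕ<n j) (≡.subst (ℕ._≤ toℕ j) (Fin.toℕ-fromℕ m) (ℕ.s≤s⁻¹ m<j))
      one : ∀ i j → payoff top top i j ≈ 1#
      one i j = trans
        (+-cong (*-cong (+-congˡ (-‿cong (reflexive (≡.cong χ (top-false j)))))
                        (+-congˡ (-‿cong (reflexive (≡.cong χ (top-false i))))))
                (*-congʳ (+-cong (reflexive (≡.cong χ (top-false j))) (reflexive (≡.cong χ (top-false i))))))
        (solve 1 (λ x → (con (+ 1) :- con +0) :* (con (+ 1) :- con +0) :+ (con +0 :+ con +0) :* x := con (+ 1)) refl _)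

    crossing≤value : ∀ {arc} → arc ∈ Network.arcs 𝒩 → crossing arc A ≤ value
    crossing≤value {arc} arc∈ = ≤-trans
      (≤-reflexive (reflexive (≡.cong (λ e → crossing e A) (Any.lookup-index arc∈))))
      (≤-trans (term≤sum {x = λ e → crossing (lookup (Network.arcs 𝒩) e) A}
        (λ e → crossing-nonNegative _ (All.lookup 𝒩-nonNegative (∈.∈-lookup e)) A) (Any.index arc∈))
        (≤-reflexive cut≈value))

    implication : ∀ {x y} → x ⟶ y [ 2# ] ∈ Network.arcs 𝒩 → A x ≡ true → A y ≡ true
    implication {x} {y} arc∈ Ax with A y in Ay
    ... | true  = ≡.refl
    ... | false = ⊥-elim (1≰0 (begin
      1#                           ≈⟨ solve 0 (con (+ 1) := (con (+ 1) :+ con (+ 1)) :- con (+ 1)) refl ⟩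
      2# - 1#                      ≡⟨ ≡.cong₂ (λ p q → (if p ∧ not q then 2# else 0#) - 1#) Ax Ay ⟨
      crossing (x ⟶ y [ 2# ]) A - 1#
                                   ≤⟨ x+d≤ (x≤y⇒0≤y-x (≤-trans (crossing≤value arc∈) value≤1))
                                        (solve 1 (λ x → con +0 := (x :- con (+ 1)) :+ (con (+ 1) :- x)) refl _) ⟩
      0#                           ∎))

    X⇒Y : ∀ i j → A (X i j) ≡ true → A (Y i j) ≡ true
    X⇒Y i j = implication (arcsAt∈ i j (there (there (there (here ≡.refl)))))

    X-increasing : ∀ i → Increasing (λ j → A (X i j))
    X-increasing i {j} k≡ = implication (arcsAt∈ i j (there (there (there (there
      (∈.∈-++⁺ʳ (map _ (allFin m)) (∈.∈-++⁺ʳ (map _ (allFin m)) (∈.∈-++⁺ˡ (arcAt∈ _ k≡)))))))))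

    -- Passing to the contrapositive of the arc from `Y k j` to `Y i j` lets the same threshold
    -- lemma serve for the complement.
    Y-decreasing : ∀ j → Increasing (λ i → not (A (Y i j)))
    Y-decreasing j {i} {k} k≡ ¬Yi with A (Y k j) in Yk
    ... | false = ≡.refl
    ... | true  = ≡.trans (≡.cong not (≡.sym (implication (arcsAt∈ i j (there (there (there (there
      (∈.∈-++⁺ʳ (map _ (allFin m)) (∈.∈-++⁺ʳ (map _ (allFin m))
        (∈.∈-++⁺ʳ (arcAt (suc j) _) (arcAt∈ (λ i⁺ → Y i⁺ j ⟶ Y i j [ 2# ]) k≡))))))))) Yk))) ¬Yi

    a* b* : Thresholds
    a* i = proj₁ (increasing⇒threshold (X-increasing i))
    b* j = proj₁ (increasing⇒threshold (Y-decreasing j))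

    A≗side : A ≗ side a* b*
    A≗side s       = source∈
    A≗side t       = sink∉
    A≗side (X i j) = proj₂ (increasing⇒threshold (X-increasing i)) j
    A≗side (Y i j) = ≡.trans (≡.sym (not-involutive (A (Y i j))))
      (≡.cong not (proj₂ (increasing⇒threshold (Y-decreasing j)) i))

    a*-b*-disjoint : ∀ i j → τ (toℕ (a* i)) (toℕ j) ∧ τ (toℕ (b* j)) (toℕ i) ≡ false
    a*-b*-disjoint i j = ≡.trans
      (≡.cong₂ _∧_ (≡.sym (A≗side (X i j))) (≡.sym (proj₂ (increasing⇒threshold (Y-decreasing j)) i)))
      (X∧¬Y (A (X i j)) (A (Y i j)) (X⇒Y i j))
      where
      X∧¬Y : ∀ p q → (p ≡ true → q ≡ true) → p ∧ not q ≡ false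
      X∧¬Y false q p⇒q = ≡.refl
      X∧¬Y true  q p⇒q = ≡.cong not (p⇒q ≡.refl)

    -- Each admissible pair yields a cut of value Γ, which gives the lower bound. It is attained
    -- because the minimum cut agrees pointwise with the cut of its own thresholds.
    Γ-minimum : IsMinimum Γ value
    Γ-minimum = (((a* , b*) , λ i j → trans (χ-∧ _ _) (reflexive (≡.cong χ (a*-b*-disjoint i j)))) , attained)
              , value≤Γ
      where
      attained : ∑∑ (payoff a* b*) * κ ≈ value
      attained = trans (sym (side-cutCapacity a* b* a*-b*-disjoint))
                       (trans (sym (cutCapacity-cong (Network.arcs 𝒩) A≗side)) cut≈value)

  minCut⇒minimum-Γ : ∀ {v} → IsMinCutValue 𝒩 v → IsMinimum Γ v
  minCut⇒minimum-Γ ((C , cut≈v) , v≤cut) = MinimumCut.Γ-minimum C cut≈v v≤cut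

open import Data.Nat.Base using (_≤_)

proposition5p1 : ∀ {c ℓ₁ ℓ₂} (K : OrderedField c ℓ₁ ℓ₂) → let open Over K in
    (m : ℕ) → 1 ≤ m → (h : StepProfile m) → let open Profile h in
    ∃[ v ] IsMaxFlowValue 𝒩 v × IsMinCutValue 𝒩 v × IsMinimum Γ v
proposition5p1 K m 1≤m h = v , max , min , minCut⇒minimum-Γ min
  where
  open Over K
  open Profile h
  open Game K 1≤m h
  mfmc : ∃[ v ] IsMaxFlowValue 𝒩 v × IsMinCutValue 𝒩 v
  mfmc = MaxFlowMinCut.max-flow-min-cut K 𝒩 nodes ∈-nodes 𝒩-nonNegative λ ()
  v = proj₁ mfmc
  max = proj₁ (proj₂ mfmc)
  min = proj₂ (proj₂ mfmc)
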